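{- Fix a constant $c>1$. In the semi-oblivious cup flushing game with multiplicative error factor $c$ on $n$ cups, the adversary can achieve backlog $e^{\Omega(\sqrt{\log n})}$ against the greedy algorithm, as $n\to\infty$ (with implied constant allowed to depend on $c$).
   Context: Semi-oblivious cup flushing game (multiplicative error factor $c>1$). There are $n$ cups, initially empty; heights are nonnegative reals. Time proceeds in discrete steps. In each step the adversary first distributes $1$ unit of water among the cups arbitrarily (nonnegative amounts summing to $1$), resulting in intermediate heights $g_1(t),\dots,g_n(t)$. The adversary then shows the player estimates $g_i'(t)\in[g_i(t),\,c\,g_i(t)]$ for each cup $i$, of the adversary's choice. The player then selects one cup and empties it entirely: the selected cup's height becomes $0$, and all other heights are unchanged. The adversary may be adaptive. Greedy algorithm: the player always selects a cup $i$ with maximal estimate $g_i'(t)$, ties broken arbitrarily; for worst-case purposes ties may be assumed to be broken as the adversary prefers. Backlog: the supremum over all time steps (including the intermediate moment after the adversary's move) of the height of the fullest cup. -}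

module Defs where

open import Data.Nat as ℕ using (ℕ; zero; suc)
import Data.Nat.Properties as ℕP
import Data.Integer as ℤ
import Data.Integer.Properties as ℤP
open import Data.Rational as ℚ using (ℚ; 0ℚ; 1ℚ)
import Data.Rational.Properties as ℚP
import Data.Rational.Unnormalised as ℚᵘ
import Data.Rational.Unnormalised.Properties as ℚᵘP
open import Data.Fin using (Fin)
open import Data.Product using (_×_; _,_; proj₁; proj₂; ∃; ∃-syntax; Σ-syntax)
open import Data.Sum using (_⊎_)
open import Data.Vec.Functional using (Vector; foldr; updateAt)
open import Function using (const)
open import Relation.Binary.PropositionalEquality
  using (_≡_; refl; sym; trans; cong; cong₂; subst; subst₂)

ℕ→ℚ : ℕ → ℚ
ℕ→ℚ n = ℤ.+ n ℚ./ 1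

-- expTerm k q = qᵏ / k!  and  expSum n q = Σ_{k < n} qᵏ / k!

expTerm : ℕ → ℚ → ℚ
expTerm zero    q = 1ℚ
expTerm (suc k) q = (expTerm k q ℚ.* q) ℚ.* (ℤ.+ 1 ℚ./ suc k)

expSum : ℕ → ℚ → ℚ
expSum zero    q = 0ℚ
expSum (suc k) q = expSum k q ℚ.+ expTerm k q

module RationalLemmas where
  open import Data.Rational using (_+_; _*_; _-_; -_; ∣_∣; _≤_; _<_; _/_; 1/_)
  open ℚP
  open import Data.Rational.Solver using (module +-*-Solver)
  open +-*-Solver using (solve; _:=_; _:+_; _:*_; _:-_; :-_; con)

  ℕ→ℚ-suc : ∀ n → ℕ→ℚ (suc n) ≡ ℕ→ℚ n + 1ℚ
  ℕ→ℚ-suc n = toℚᵘ-injective (ℚᵘP.≃-trans (toℚᵘ-fromℚᵘ (ℚᵘ.mkℚᵘ (ℤ.+ suc n) 0))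
    (ℚᵘP.≃-sym (ℚᵘP.≃-trans (toℚᵘ-homo-+ (ℕ→ℚ n) 1ℚ)
      (ℚᵘP.≃-trans (ℚᵘP.+-congˡ (ℚ.toℚᵘ 1ℚ) (toℚᵘ-fromℚᵘ (ℚᵘ.mkℚᵘ (ℤ.+ n) 0))) (ℚᵘ.*≡* eq)))))
    where
    eq : (ℤ.+ n ℤ.* ℤ.+ 1 ℤ.+ ℤ.+ 1 ℤ.* ℤ.+ 1) ℤ.* ℤ.+ 1 ≡ ℤ.+ suc n ℤ.* ℤ.+ 1
    eq = cong (ℤ._* ℤ.+ 1) (trans (cong (ℤ._+ ℤ.+ 1) (ℤP.*-identityʳ (ℤ.+ n))) (cong ℤ.+_ (ℕP.+-comm n 1)))

  recip-suc : ∀ n → ℕ→ℚ (suc n) * (ℤ.+ 1 / suc n) ≡ 1ℚ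
  recip-suc n = toℚᵘ-injective (ℚᵘP.≃-trans (toℚᵘ-homo-* (ℕ→ℚ (suc n)) (ℤ.+ 1 / suc n))
      (ℚᵘP.≃-trans (ℚᵘP.*-cong (toℚᵘ-fromℚᵘ (ℚᵘ.mkℚᵘ (ℤ.+ suc n) 0)) (toℚᵘ-fromℚᵘ (ℚᵘ.mkℚᵘ (ℤ.+ 1) n)))
        (ℚᵘ.*≡* eq)))
    where
    eq : (ℤ.+ suc n ℤ.* ℤ.+ 1) ℤ.* ℤ.+ 1 ≡ ℤ.+ 1 ℤ.* (ℤ.+ 1 ℤ.* ℤ.+ suc n)
    eq = trans (ℤP.*-identityʳ _) (trans (ℤP.*-comm (ℤ.+ suc n) (ℤ.+ 1)) (sym (ℤP.*-identityˡ _)))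

  0≤ℕ→ℚ : ∀ n → 0ℚ ≤ ℕ→ℚ n
  0≤ℕ→ℚ zero    = ≤-refl
  0≤ℕ→ℚ (suc n) = ≤-trans (+-mono-≤ (0≤ℕ→ℚ n) (ℚP.nonNegative⁻¹ 1ℚ)) (≤-reflexive (sym (ℕ→ℚ-suc n)))

  ℕ→ℚ-≤-suc : ∀ n → ℕ→ℚ n ≤ ℕ→ℚ (suc n)
  ℕ→ℚ-≤-suc n = ≤-trans (≤-reflexive (sym (+-identityʳ _)))
    (≤-trans (+-monoʳ-≤ (ℕ→ℚ n) (ℚP.nonNegative⁻¹ 1ℚ)) (≤-reflexive (sym (ℕ→ℚ-suc n))))

  ℕ→ℚ-mono : ∀ {m n} → m ℕ.≤ n → ℕ→ℚ m ≤ ℕ→ℚ n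
  ℕ→ℚ-mono {n = n} ℕ.z≤n = 0≤ℕ→ℚ n
  ℕ→ℚ-mono (ℕ.s≤s {m} {n} m≤n) = subst₂ _≤_ (sym (ℕ→ℚ-suc m)) (sym (ℕ→ℚ-suc n))
    (+-monoˡ-≤ 1ℚ (ℕ→ℚ-mono m≤n))

  0<ℕ→ℚ-suc : ∀ n → 0ℚ < ℕ→ℚ (suc n)
  0<ℕ→ℚ-suc n = <-≤-trans (ℚP.positive⁻¹ 1ℚ) (ℕ→ℚ-mono {1} {suc n} (ℕ.s≤s ℕ.z≤n))

  bound : ∀ p → ∃[ k ] p ≤ ℕ→ℚ k
  bound p@(ℚ.mkℚ n d c) = ℤ.∣ n ∣ , toℚᵘ-cancel-≤
     (ℚᵘP.≤-respʳ-≃ (ℚᵘP.≃-sym (toℚᵘ-fromℚᵘ (ℚᵘ.mkℚᵘ (ℤ.+ ℤ.∣ n ∣) 0))) (ℚᵘ.*≤* (le n)))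
    where
    le : ∀ n → n ℤ.* ℤ.+ 1 ℤ.≤ ℤ.+ ℤ.∣ n ∣ ℤ.* ℤ.+ suc d
    le (ℤ.+ m) rewrite ℤP.*-identityʳ (ℤ.+ m) | sym (ℤP.pos-* m (suc d)) =
      ℤ.+≤+ (ℕP.m≤m*n m (suc d))
    le (ℤ.-[1+ m ]) rewrite ℤP.*-identityʳ ℤ.-[1+ m ] = ℤ.-≤+

  *-mono-nonNeg : ∀ {p q r s} → 0ℚ ≤ p → 0ℚ ≤ s → p ≤ q → r ≤ s → p * r ≤ q * s
  *-mono-nonNeg {p} {q} {r} {s} 0≤p 0≤s p≤q r≤s =
    ≤-trans (*-monoˡ-≤-nonNeg p {{ℚ.nonNegative 0≤p}} r≤s)
            (*-monoʳ-≤-nonNeg s {{ℚ.nonNegative 0≤s}} p≤q)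

  0≤* : ∀ {p q} → 0ℚ ≤ p → 0ℚ ≤ q → 0ℚ ≤ p * q
  0≤* {p} {q} 0≤p 0≤q = nonNegative⁻¹ (p * q)
    {{nonNeg*nonNeg⇒nonNeg p {{ℚ.nonNegative 0≤p}} q {{ℚ.nonNegative 0≤q}}}}

  scale : ∀ {b ε} → 0ℚ < b → 0ℚ < ε → ∃[ δ ] (0ℚ < δ × b * δ ≡ ε)
  scale {b} {ε} 0<b 0<ε = (1/ b) * ε ,
      positive⁻¹ _ {{pos*pos⇒pos (1/ b) {{1/pos⇒pos b}} ε}} ,
      trans (sym (*-assoc b (1/ b) ε)) (trans (cong (_* ε) (*-inverseʳ b)) (*-identityˡ ε))
    where instance
      b-pos = ℚ.positive 0<b
      ε-pos = ℚ.positive 0<ε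
      b-nz  = pos⇒nonZero b

  halve : ∀ {ε} → 0ℚ < ε → ∃[ δ ] (0ℚ < δ × δ + δ ≡ ε)
  halve {ε} 0<ε with scale (positive⁻¹ (1ℚ + 1ℚ)) 0<ε
  ... | δ , 0<δ , eq = δ , 0<δ , trans (solve 1 (λ d → d :+ d := (con 1ℚ :+ con 1ℚ) :* d) refl δ) eq

  archimedean : ∀ p {ε} → 0ℚ < ε → ∃[ k ] p ≤ ℕ→ℚ k * ε
  archimedean p {ε} 0<ε with bound (p * (1/ ε))
    where instance
      ε-pos = ℚ.positive 0<ε
      ε-nz  = pos⇒nonZero ε
  ... | k , le = k , ≤-trans (≤-reflexive eq) (*-monoʳ-≤-nonNeg ε {{pos⇒nonNeg ε}} le)
    where
    instance
      ε-pos = ℚ.positive 0<ε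
      ε-nz  = pos⇒nonZero ε
    eq : p ≡ p * (1/ ε) * ε
    eq = sym (trans (*-assoc p (1/ ε) ε) (trans (cong (p *_) (*-inverseˡ ε)) (*-identityʳ p)))

  ∣-∣-sym : ∀ p q → ∣ p - q ∣ ≡ ∣ q - p ∣
  ∣-∣-sym p q = trans (cong ∣_∣ (solve 2 (λ p q → p :- q := :- (q :- p)) refl p q)) (∣-p∣≡∣p∣ (q - p))

  ∣-∣-triangle : ∀ p q r → ∣ p - r ∣ ≤ ∣ p - q ∣ + ∣ q - r ∣
  ∣-∣-triangle p q r = ≤-trans
    (≤-reflexive (cong ∣_∣ (solve 3 (λ p q r → p :- r := (p :- q) :+ (q :- r)) refl p q r)))
    (∣p+q∣≤∣p∣+∣q∣ (p - q) (q - r))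

  ∣p-p∣≡0 : ∀ p → ∣ p - p ∣ ≡ 0ℚ
  ∣p-p∣≡0 p = cong ∣_∣ (+-inverseʳ p)

  ∣+-+∣ : ∀ p p′ q q′ → ∣ (p + q) - (p′ + q′) ∣ ≤ ∣ p - p′ ∣ + ∣ q - q′ ∣
  ∣+-+∣ p p′ q q′ = ≤-trans (≤-reflexive (cong ∣_∣
      (solve 4 (λ p p′ q q′ → (p :+ q) :- (p′ :+ q′) := (p :- p′) :+ (q :- q′)) refl p p′ q q′)))
    (∣p+q∣≤∣p∣+∣q∣ (p - p′) (q - q′))

  ∣*-*∣ : ∀ p p′ q q′ → ∣ p * q - p′ * q′ ∣ ≤ ∣ p - p′ ∣ * ∣ q ∣ + ∣ p′ ∣ * ∣ q - q′ ∣
  ∣*-*∣ p p′ q q′ = ≤-trans (≤-reflexive (cong ∣_∣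
      (solve 4 (λ p p′ q q′ → p :* q :- p′ :* q′ := (p :- p′) :* q :+ p′ :* (q :- q′)) refl p p′ q q′)))
    (≤-trans (∣p+q∣≤∣p∣+∣q∣ ((p - p′) * q) (p′ * (q - q′)))
      (≤-reflexive (cong₂ _+_ (∣p*q∣≡∣p∣*∣q∣ (p - p′) q) (∣p*q∣≡∣p∣*∣q∣ p′ (q - q′)))))

  private
    0≤recip : ∀ k → 0ℚ ≤ ℤ.+ 1 / suc k
    0≤recip k = nonNegative⁻¹ _ {{normalize-nonNeg 1 (suc k)}}

  expTerm-nonNeg : ∀ k {b} → 0ℚ ≤ b → 0ℚ ≤ expTerm k b
  expTerm-nonNeg zero    0≤b = nonNegative⁻¹ 1ℚ
  expTerm-nonNeg (suc k) 0≤b = 0≤* (0≤* (expTerm-nonNeg k 0≤b) 0≤b) (0≤recip k)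

  expTerm-suc : ∀ k b → ℕ→ℚ (suc k) * expTerm (suc k) b ≡ expTerm k b * b
  expTerm-suc k b = trans
    (solve 3 (λ n x r → n :* (x :* r) := x :* (n :* r)) refl (ℕ→ℚ (suc k)) (expTerm k b * b) (ℤ.+ 1 / suc k))
    (trans (cong ((expTerm k b * b) *_) (recip-suc k)) (*-identityʳ _))

  ∣expTerm∣ : ∀ k {a b} → ∣ a ∣ ≤ b → ∣ expTerm k a ∣ ≤ expTerm k b
  ∣expTerm∣ zero    a≤b = ≤-refl
  ∣expTerm∣ (suc k) {a} {b} a≤b = begin
    ∣ (expTerm k a * a) * r ∣       ≡⟨ ∣p*q∣≡∣p∣*∣q∣ (expTerm k a * a) r ⟩
    ∣ expTerm k a * a ∣ * ∣ r ∣     ≡⟨ cong₂ _*_ (∣p*q∣≡∣p∣*∣q∣ (expTerm k a) a) (0≤p⇒∣p∣≡p (0≤recip k)) ⟩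
    (∣ expTerm k a ∣ * ∣ a ∣) * r   ≤⟨ *-monoʳ-≤-nonNeg r {{ℚ.nonNegative (0≤recip k)}}
                                       (*-mono-nonNeg (0≤∣p∣ _) 0≤b (∣expTerm∣ k a≤b) a≤b) ⟩
    (expTerm k b * b) * r           ∎
    where
    open ≤-Reasoning
    r = ℤ.+ 1 / suc k
    0≤b = ≤-trans (0≤∣p∣ a) a≤b

  module _ {a a′ b : ℚ} (a≤b : ∣ a ∣ ≤ b) (a′≤b : ∣ a′ ∣ ≤ b) where
    private
      0≤b = ≤-trans (0≤∣p∣ a) a≤b
      d = ∣ a - a′ ∣
      0≤d = 0≤∣p∣ (a - a′)

    mutual
      expTerm-lip* : ∀ k → ∣ expTerm k a - expTerm k a′ ∣ * b ≤ (d * ℕ→ℚ k) * expTerm k b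
      expTerm-lip* zero    = ≤-reflexive (trans (*-zeroˡ b)
        (sym (trans (cong (_* 1ℚ) (*-zeroʳ d)) (*-zeroˡ 1ℚ))))
      expTerm-lip* (suc k) = ≤-trans
        (*-monoʳ-≤-nonNeg b {{ℚ.nonNegative 0≤b}} (expTerm-lip k))
        (≤-reflexive (trans (*-assoc d _ b)
          (trans (cong (d *_) (sym (expTerm-suc k b))) (sym (*-assoc d _ _)))))

      expTerm-lip : ∀ k → ∣ expTerm (suc k) a - expTerm (suc k) a′ ∣ ≤ d * expTerm k b
      expTerm-lip k = begin
        ∣ (t * a) * r - (t′ * a′) * r ∣
          ≡⟨ cong ∣_∣ (solve 3 (λ x y r → x :* r :- y :* r := (x :- y) :* r) refl (t * a) (t′ * a′) r) ⟩
        ∣ (t * a - t′ * a′) * r ∣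
          ≡⟨ trans (∣p*q∣≡∣p∣*∣q∣ (t * a - t′ * a′) r) (cong (∣ t * a - t′ * a′ ∣ *_) (0≤p⇒∣p∣≡p (0≤recip k))) ⟩
        ∣ t * a - t′ * a′ ∣ * r
          ≤⟨ mono-r (∣*-*∣ t t′ a a′) ⟩
        (∣ t - t′ ∣ * ∣ a ∣ + ∣ t′ ∣ * d) * r
          ≤⟨ mono-r (+-mono-≤
               (*-monoˡ-≤-nonNeg ∣ t - t′ ∣ {{∣-∣-nonNeg (t - t′)}} a≤b)
               (*-monoʳ-≤-nonNeg d {{ℚ.nonNegative 0≤d}} (∣expTerm∣ k a′≤b))) ⟩
        (∣ t - t′ ∣ * b + s * d) * r
          ≤⟨ mono-r (+-monoˡ-≤ (s * d) (expTerm-lip* k)) ⟩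
        ((d * ℕ→ℚ k) * s + s * d) * r
          ≡⟨ solve 4 (λ d n s r → ((d :* n) :* s :+ s :* d) :* r := (d :* s) :* ((n :+ con 1ℚ) :* r)) refl d (ℕ→ℚ k) s r ⟩
        (d * s) * ((ℕ→ℚ k + 1ℚ) * r)
          ≡⟨ cong (λ z → (d * s) * (z * r)) (sym (ℕ→ℚ-suc k)) ⟩
        (d * s) * (ℕ→ℚ (suc k) * r)
          ≡⟨ trans (cong ((d * s) *_) (recip-suc k)) (*-identityʳ _) ⟩
        d * s ∎
        where
        open ≤-Reasoning
        r = ℤ.+ 1 / suc k
        t = expTerm k a
        t′ = expTerm k a′
        s = expTerm k b
        mono-r : ∀ {x y} → x ≤ y → x * r ≤ y * r
        mono-r = *-monoʳ-≤-nonNeg r {{ℚ.nonNegative (0≤recip k)}}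

    private
      lip-suc : ∀ n → ∣ expSum (suc n) a - expSum (suc n) a′ ∣ ≤ d * expSum n b
      lip-suc zero    = ≤-reflexive (sym (*-zeroʳ d))
      lip-suc (suc n) = ≤-trans
        (∣+-+∣ (expSum (suc n) a) (expSum (suc n) a′) (expTerm (suc n) a) (expTerm (suc n) a′))
        (≤-trans (+-mono-≤ (lip-suc n) (expTerm-lip n))
          (≤-reflexive (sym (*-distribˡ-+ d (expSum n b) (expTerm n b)))))

    expSum-lip : ∀ n → ∣ expSum n a - expSum n a′ ∣ ≤ d * expSum n b
    expSum-lip zero    = ≤-reflexive (sym (*-zeroʳ d))
    expSum-lip (suc n) = ≤-trans (lip-suc n) (*-monoˡ-≤-nonNeg d {{ℚ.nonNegative 0≤d}}
      (≤-trans (≤-reflexive (sym (+-identityʳ _))) (+-monoʳ-≤ (expSum n b) (expTerm-nonNeg n 0≤b))))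

  expSum-diff : ∀ {a b} → ∣ a ∣ ≤ b → ∀ {m n} → m ℕ.≤′ n →
                ∣ expSum n a - expSum m a ∣ ≤ expSum n b - expSum m b
  expSum-diff {a} {b} a≤b {m} (ℕ.≤′-reflexive refl) =
    ≤-reflexive (trans (∣p-p∣≡0 (expSum m a)) (sym (+-inverseʳ (expSum m b))))
  expSum-diff {a} {b} a≤b {m} (ℕ.≤′-step {n} m≤n) = begin
    ∣ (expSum n a + expTerm n a) - expSum m a ∣
      ≡⟨ cong ∣_∣ (shift (expSum n a) (expTerm n a) (expSum m a)) ⟩
    ∣ (expSum n a - expSum m a) + expTerm n a ∣
      ≤⟨ ∣p+q∣≤∣p∣+∣q∣ (expSum n a - expSum m a) (expTerm n a) ⟩
    ∣ expSum n a - expSum m a ∣ + ∣ expTerm n a ∣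
      ≤⟨ +-mono-≤ (expSum-diff a≤b m≤n) (∣expTerm∣ n a≤b) ⟩
    (expSum n b - expSum m b) + expTerm n b
      ≡⟨ sym (shift (expSum n b) (expTerm n b) (expSum m b)) ⟩
    (expSum n b + expTerm n b) - expSum m b ∎
    where
    open ≤-Reasoning
    shift : ∀ x y z → (x + y) - z ≡ (x - z) + y
    shift = solve 3 (λ x y z → (x :+ y) :- z := (x :- z) :+ y) refl

  module Tail (K : ℕ) where
    private
      b = ℕ→ℚ (suc K)
      0<b = 0<ℕ→ℚ-suc K
      0≤b = <⇒≤ 0<b
      instance
        b-pos = ℚ.positive 0<b
        b-nonNeg = ℚ.nonNegative 0≤b

    onset : ℕ
    onset = suc K ℕ.+ suc K

    private
      ℕ→ℚ-+ : ∀ m n → ℕ→ℚ (m ℕ.+ n) ≡ ℕ→ℚ m + ℕ→ℚ n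
      ℕ→ℚ-+ zero n = sym (+-identityˡ _)
      ℕ→ℚ-+ (suc m) n = trans (ℕ→ℚ-suc (m ℕ.+ n)) (trans (cong (_+ 1ℚ) (ℕ→ℚ-+ m n))
        (trans (solve 2 (λ x y → (x :+ y) :+ con 1ℚ := (x :+ con 1ℚ) :+ y) refl (ℕ→ℚ m) (ℕ→ℚ n))
          (cong (_+ ℕ→ℚ n) (sym (ℕ→ℚ-suc m)))))

    expTerm-halves : ∀ {k} → onset ℕ.≤ k → expTerm (suc k) b + expTerm (suc k) b ≤ expTerm k b
    expTerm-halves {k} le = *-cancelʳ-≤-pos b (begin
      (t + t) * b              ≡⟨ solve 2 (λ t b → (t :+ t) :* b := (b :+ b) :* t) refl t b ⟩
      (b + b) * t              ≡⟨ cong (_* t) (sym (ℕ→ℚ-+ (suc K) (suc K))) ⟩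
      ℕ→ℚ onset * t            ≤⟨ *-monoʳ-≤-nonNeg t {{ℚ.nonNegative (expTerm-nonNeg (suc k) 0≤b)}}
                                    (ℕ→ℚ-mono (ℕP.m≤n⇒m≤1+n le)) ⟩
      ℕ→ℚ (suc k) * t          ≡⟨ expTerm-suc k b ⟩
      expTerm k b * b          ∎)
      where
      open ≤-Reasoning
      t = expTerm (suc k) b

    expTerm-anti : ∀ {m n} → onset ℕ.≤ m → m ℕ.≤′ n → expTerm n b ≤ expTerm m b
    expTerm-anti le (ℕ.≤′-reflexive refl) = ≤-refl
    expTerm-anti {m} le (ℕ.≤′-step {n} m≤n) = ≤-trans
      (≤-trans (≤-reflexive (sym (+-identityʳ _)))
        (≤-trans (+-monoʳ-≤ (expTerm (suc n) b) (expTerm-nonNeg (suc n) 0≤b))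
          (expTerm-halves (ℕP.≤-trans le (ℕP.≤′⇒≤ m≤n)))))
      (expTerm-anti le m≤n)

    majorant : ℕ → ℚ
    majorant n = expSum n b + (expTerm n b + expTerm n b)

    majorant-anti : ∀ {m n} → onset ℕ.≤ m → m ℕ.≤′ n → majorant n ≤ majorant m
    majorant-anti le (ℕ.≤′-reflexive refl) = ≤-refl
    majorant-anti {m} le (ℕ.≤′-step {n} m≤n) = ≤-trans
      (≤-trans (+-monoʳ-≤ (expSum n b + expTerm n b) (expTerm-halves (ℕP.≤-trans le (ℕP.≤′⇒≤ m≤n))))
        (≤-reflexive (+-assoc (expSum n b) (expTerm n b) (expTerm n b))))
      (majorant-anti le m≤n)

    private
      0≤tt : ∀ n → 0ℚ ≤ expTerm n b + expTerm n b
      0≤tt n = +-mono-≤ (expTerm-nonNeg n 0≤b) (expTerm-nonNeg n 0≤b)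

    expSum≤majorant : ∀ n → expSum n b ≤ majorant n
    expSum≤majorant n = ≤-trans (≤-reflexive (sym (+-identityʳ _))) (+-monoʳ-≤ (expSum n b) (0≤tt n))

    0≤expSum : ∀ n → 0ℚ ≤ expSum n b
    0≤expSum zero    = ≤-refl
    0≤expSum (suc n) = +-mono-≤ (0≤expSum n) (expTerm-nonNeg n 0≤b)

    total : ℚ
    total = majorant onset

    expSum≤total : ∀ {n} → onset ℕ.≤ n → expSum n b ≤ total
    expSum≤total {n} le = ≤-trans (expSum≤majorant n) (majorant-anti ℕP.≤-refl (ℕP.≤⇒≤′ le))

    0≤total : 0ℚ ≤ total
    0≤total = ≤-trans (0≤expSum onset) (expSum≤majorant onset)

    expTerm≤total : ∀ {n} → onset ℕ.≤ n → expTerm n b ≤ total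
    expTerm≤total {n} le = ≤-trans
      (≤-trans (≤-reflexive (sym (+-identityˡ _)))
        (≤-trans (+-monoˡ-≤ (expTerm n b) (+-mono-≤ (0≤expSum n) (expTerm-nonNeg n 0≤b)))
          (≤-reflexive (+-assoc (expSum n b) (expTerm n b) (expTerm n b)))))
      (majorant-anti ℕP.≤-refl (ℕP.≤⇒≤′ le))

    private
      small : ∀ {ε Q} → 0ℚ < ε → total * b ≤ ℕ→ℚ Q * ε → ∀ N → Q ℕ.≤ suc N → onset ℕ.≤ N →
              expTerm (suc N) b ≤ ε
      small {ε} {Q} 0<ε le N Q≤N onset≤N = *-cancelˡ-≤-pos (ℕ→ℚ (suc N)) {{ℚ.positive (0<ℕ→ℚ-suc N)}} (begin
        ℕ→ℚ (suc N) * expTerm (suc N) b  ≡⟨ expTerm-suc N b ⟩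
        expTerm N b * b                  ≤⟨ *-monoʳ-≤-nonNeg b (expTerm≤total onset≤N) ⟩
        total * b                        ≤⟨ le ⟩
        ℕ→ℚ Q * ε                        ≤⟨ *-monoʳ-≤-nonNeg ε {{ℚ.nonNegative (<⇒≤ 0<ε)}} (ℕ→ℚ-mono Q≤N) ⟩
        ℕ→ℚ (suc N) * ε                  ∎)
        where open ≤-Reasoning

    expTerm-small : ∀ {ε} → 0ℚ < ε → ∃[ N ] (onset ℕ.≤ N × expTerm N b ≤ ε)
    expTerm-small 0<ε =
      let (Q , le) = archimedean (total * b) 0<ε
          N = onset ℕ.+ Q
      in suc N , ℕP.m≤n⇒m≤1+n (ℕP.m≤m+n onset Q) ,
         small 0<ε le N (ℕP.m≤n⇒m≤1+n (ℕP.m≤n+m Q onset)) (ℕP.m≤m+n onset Q)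

    expSum-tail : ∀ {a} → ∣ a ∣ ≤ b → ∀ {m n} → onset ℕ.≤ m → m ℕ.≤ n →
                  ∣ expSum n a - expSum m a ∣ ≤ expTerm m b + expTerm m b
    expSum-tail {a} a≤b {m} {n} le m≤n = begin
      ∣ expSum n a - expSum m a ∣     ≤⟨ expSum-diff a≤b (ℕP.≤⇒≤′ m≤n) ⟩
      expSum n b - expSum m b         ≤⟨ +-monoˡ-≤ (- expSum m b)
                                           (≤-trans (expSum≤majorant n) (majorant-anti le (ℕP.≤⇒≤′ m≤n))) ⟩
      majorant m - expSum m b         ≡⟨ solve 2 (λ x y → (x :+ y) :- x := y) refl (expSum m b) (expTerm m b + expTerm m b) ⟩
      expTerm m b + expTerm m b       ∎
      where open ≤-Reasoning

-- Real numbers are Cauchy sequences of rationals, each carrying a modulus; two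
-- sequences denote the same real number when they are related by _≈_.

record ℝ : Set where
  constructor mkℝ
  field
    seq    : ℕ → ℚ
    cauchy : ∀ ε → 0ℚ ℚ.< ε → ∃[ N ] ∀ m n → N ℕ.≤ m → N ℕ.≤ n →
             ℚ.∣ seq m ℚ.- seq n ∣ ℚ.≤ ε
open ℝ public

infix  4 _≈_ _≤_ _<_
infixl 6 _+_
infixl 7 _*_

-- Opaque, here and below, only because unfolding arithmetic on ℚ is expensive.

opaque
  _≈_ : ℝ → ℝ → Set
  x ≈ y = ∀ ε → 0ℚ ℚ.< ε → ∃[ N ] ∀ n → N ℕ.≤ n → ℚ.∣ seq x n ℚ.- seq y n ∣ ℚ.≤ ε

  _≤_ : ℝ → ℝ → Set
  x ≤ y = ∀ ε → 0ℚ ℚ.< ε → ∃[ N ] ∀ n → N ℕ.≤ n → seq x n ℚ.≤ seq y n ℚ.+ ε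

  _<_ : ℝ → ℝ → Set
  x < y = ∃[ ε ] (0ℚ ℚ.< ε × ∃[ N ] ∀ n → N ℕ.≤ n → seq x n ℚ.+ ε ℚ.≤ seq y n)

module CauchyLemmas where
  open import Data.Rational.Solver using (module +-*-Solver)
  open +-*-Solver using (solve; _:=_; _:+_; _:-_)
  open RationalLemmas
  open ℚP.≤-Reasoning

  const-cauchy : ∀ q ε → 0ℚ ℚ.< ε → ∃[ N ] ∀ m n → N ℕ.≤ m → N ℕ.≤ n → ℚ.∣ q ℚ.- q ∣ ℚ.≤ ε
  const-cauchy q ε 0<ε = 0 , λ _ _ _ _ → ℚP.≤-trans (ℚP.≤-reflexive (∣p-p∣≡0 q)) (ℚP.<⇒≤ 0<ε)

  fromBase : (x : ℕ → ℚ) →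
    (∀ ε → 0ℚ ℚ.< ε → ∃[ N ] ∀ n → N ℕ.≤ n → ℚ.∣ x n ℚ.- x N ∣ ℚ.≤ ε) →
    ∀ ε → 0ℚ ℚ.< ε → ∃[ N ] ∀ m n → N ℕ.≤ m → N ℕ.≤ n → ℚ.∣ x m ℚ.- x n ∣ ℚ.≤ ε
  fromBase x base ε 0<ε =
    let (η , 0<η , η+η≡ε) = halve 0<ε
        (N , near)        = base η 0<η
    in N , λ m n N≤m N≤n → begin
      ℚ.∣ x m ℚ.- x n ∣                          ≤⟨ ∣-∣-triangle (x m) (x N) (x n) ⟩
      ℚ.∣ x m ℚ.- x N ∣ ℚ.+ ℚ.∣ x N ℚ.- x n ∣    ≡⟨ cong (ℚ.∣ x m ℚ.- x N ∣ ℚ.+_) (∣-∣-sym (x N) (x n)) ⟩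
      ℚ.∣ x m ℚ.- x N ∣ ℚ.+ ℚ.∣ x n ℚ.- x N ∣    ≤⟨ ℚP.+-mono-≤ (near m N≤m) (near n N≤n) ⟩
      η ℚ.+ η                                    ≡⟨ η+η≡ε ⟩
      ε                                          ∎

  bounded : ∀ x → ∃[ K ] ∃[ N ] ∀ n → N ℕ.≤ n → ℚ.∣ seq x n ∣ ℚ.≤ ℕ→ℚ (suc K)
  bounded x =
    let (N , near) = cauchy x 1ℚ (ℚP.positive⁻¹ 1ℚ)
        (K , le)   = bound ℚ.∣ seq x N ∣
    in K , N , λ n N≤n → begin
      ℚ.∣ seq x n ∣
        ≡⟨ cong ℚ.∣_∣ (solve 2 (λ p q → p := q :+ (p :- q)) refl (seq x n) (seq x N)) ⟩
      ℚ.∣ seq x N ℚ.+ (seq x n ℚ.- seq x N) ∣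
        ≤⟨ ℚP.∣p+q∣≤∣p∣+∣q∣ (seq x N) (seq x n ℚ.- seq x N) ⟩
      ℚ.∣ seq x N ∣ ℚ.+ ℚ.∣ seq x n ℚ.- seq x N ∣
        ≤⟨ ℚP.+-mono-≤ le (near n N N≤n ℕP.≤-refl) ⟩
      ℕ→ℚ K ℚ.+ 1ℚ
        ≡⟨ sym (ℕ→ℚ-suc K) ⟩
      ℕ→ℚ (suc K) ∎

  +-cauchy : ∀ x y ε → 0ℚ ℚ.< ε → ∃[ N ] ∀ m n → N ℕ.≤ m → N ℕ.≤ n →
             ℚ.∣ (seq x m ℚ.+ seq y m) ℚ.- (seq x n ℚ.+ seq y n) ∣ ℚ.≤ ε
  +-cauchy x y ε 0<ε =
    let (η , 0<η , η+η≡ε) = halve 0<ε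
        (M , nearx) = cauchy x η 0<η
        (N , neary) = cauchy y η 0<η
    in M ℕ.⊔ N , λ m n le le′ → begin
      ℚ.∣ (seq x m ℚ.+ seq y m) ℚ.- (seq x n ℚ.+ seq y n) ∣
        ≤⟨ ∣+-+∣ (seq x m) (seq x n) (seq y m) (seq y n) ⟩
      ℚ.∣ seq x m ℚ.- seq x n ∣ ℚ.+ ℚ.∣ seq y m ℚ.- seq y n ∣
        ≤⟨ ℚP.+-mono-≤ (nearx m n (ℕP.m⊔n≤o⇒m≤o M N le) (ℕP.m⊔n≤o⇒m≤o M N le′))
                       (neary m n (ℕP.m⊔n≤o⇒n≤o M N le) (ℕP.m⊔n≤o⇒n≤o M N le′)) ⟩
      η ℚ.+ η  ≡⟨ η+η≡ε ⟩
      ε        ∎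

  *-cauchy : ∀ x y ε → 0ℚ ℚ.< ε → ∃[ N ] ∀ m n → N ℕ.≤ m → N ℕ.≤ n →
             ℚ.∣ seq x m ℚ.* seq y m ℚ.- seq x n ℚ.* seq y n ∣ ℚ.≤ ε
  *-cauchy x y ε 0<ε =
    let (K , A , boundx) = bounded x
        (L , B , boundy) = bounded y
        (η , 0<η , η+η≡ε) = halve 0<ε
        (η₁ , 0<η₁ , eq₁) = scale (0<ℕ→ℚ-suc L) 0<η
        (η₂ , 0<η₂ , eq₂) = scale (0<ℕ→ℚ-suc K) 0<η
        (C , nearx) = cauchy x η₁ 0<η₁
        (D , neary) = cauchy y η₂ 0<η₂
    in (A ℕ.⊔ B) ℕ.⊔ (C ℕ.⊔ D) , λ m n le le′ →
      let AB≤m = ℕP.m⊔n≤o⇒m≤o (A ℕ.⊔ B) (C ℕ.⊔ D) le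
          CD≤m = ℕP.m⊔n≤o⇒n≤o (A ℕ.⊔ B) (C ℕ.⊔ D) le
          AB≤n = ℕP.m⊔n≤o⇒m≤o (A ℕ.⊔ B) (C ℕ.⊔ D) le′
          CD≤n = ℕP.m⊔n≤o⇒n≤o (A ℕ.⊔ B) (C ℕ.⊔ D) le′
      in begin
      ℚ.∣ seq x m ℚ.* seq y m ℚ.- seq x n ℚ.* seq y n ∣
        ≤⟨ ∣*-*∣ (seq x m) (seq x n) (seq y m) (seq y n) ⟩
      ℚ.∣ seq x m ℚ.- seq x n ∣ ℚ.* ℚ.∣ seq y m ∣ ℚ.+ ℚ.∣ seq x n ∣ ℚ.* ℚ.∣ seq y m ℚ.- seq y n ∣
        ≤⟨ ℚP.+-mono-≤
             (*-mono-nonNeg (ℚP.0≤∣p∣ (seq x m ℚ.- seq x n)) (0≤ℕ→ℚ (suc L))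
               (nearx m n (ℕP.m⊔n≤o⇒m≤o C D CD≤m) (ℕP.m⊔n≤o⇒m≤o C D CD≤n))
               (boundy m (ℕP.m⊔n≤o⇒n≤o A B AB≤m)))
             (*-mono-nonNeg (ℚP.0≤∣p∣ (seq x n)) (ℚP.<⇒≤ 0<η₂)
               (boundx n (ℕP.m⊔n≤o⇒m≤o A B AB≤n))
               (neary m n (ℕP.m⊔n≤o⇒n≤o C D CD≤m) (ℕP.m⊔n≤o⇒n≤o C D CD≤n))) ⟩
      η₁ ℚ.* ℕ→ℚ (suc L) ℚ.+ ℕ→ℚ (suc K) ℚ.* η₂
        ≡⟨ cong₂ ℚ._+_ (trans (ℚP.*-comm η₁ (ℕ→ℚ (suc L))) eq₁) eq₂ ⟩
      η ℚ.+ η  ≡⟨ η+η≡ε ⟩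
      ε        ∎

  exp-cauchy : ∀ x ε → 0ℚ ℚ.< ε → ∃[ N ] ∀ m n → N ℕ.≤ m → N ℕ.≤ n →
               ℚ.∣ expSum m (seq x m) ℚ.- expSum n (seq x n) ∣ ℚ.≤ ε
  exp-cauchy x = fromBase (λ n → expSum n (seq x n)) base
    where
    K A : ℕ
    K = proj₁ (bounded x)
    A = proj₁ (proj₂ (bounded x))
    boundx : ∀ n → A ℕ.≤ n → ℚ.∣ seq x n ∣ ℚ.≤ ℕ→ℚ (suc K)
    boundx = proj₂ (proj₂ (bounded x))
    open Tail K

    0<1+total : 0ℚ ℚ.< 1ℚ ℚ.+ total
    0<1+total = ℚP.<-≤-trans (ℚP.positive⁻¹ 1ℚ)
      (ℚP.≤-trans (ℚP.≤-reflexive (sym (ℚP.+-identityʳ 1ℚ))) (ℚP.+-monoʳ-≤ 1ℚ 0≤total))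

    total≤1+total : total ℚ.≤ 1ℚ ℚ.+ total
    total≤1+total = ℚP.≤-trans (ℚP.≤-reflexive (sym (ℚP.+-identityˡ total)))
      (ℚP.+-monoˡ-≤ total (ℚP.nonNegative⁻¹ 1ℚ))

    base : ∀ ε → 0ℚ ℚ.< ε → ∃[ N ] ∀ n → N ℕ.≤ n →
           ℚ.∣ expSum n (seq x n) ℚ.- expSum N (seq x N) ∣ ℚ.≤ ε
    base ε 0<ε =
      let (η , 0<η , η+η≡ε) = halve 0<ε
          (θ , 0<θ , θ+θ≡η) = halve 0<η
          (ζ , 0<ζ , eq)    = scale 0<1+total 0<η
          (C , nearx)       = cauchy x ζ 0<ζ
          (D , onset≤D , small) = expTerm-small 0<θ
      in combine η θ ζ η+η≡ε θ+θ≡η eq 0<ζ C nearx D onset≤D small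
      where
      combine : ∀ η θ ζ → η ℚ.+ η ≡ ε → θ ℚ.+ θ ≡ η → (1ℚ ℚ.+ total) ℚ.* ζ ≡ η → 0ℚ ℚ.< ζ →
        ∀ C → (∀ m n → C ℕ.≤ m → C ℕ.≤ n → ℚ.∣ seq x m ℚ.- seq x n ∣ ℚ.≤ ζ) →
        ∀ D → onset ℕ.≤ D → expTerm D (ℕ→ℚ (suc K)) ℚ.≤ θ →
        ∃[ N ] ∀ n → N ℕ.≤ n → ℚ.∣ expSum n (seq x n) ℚ.- expSum N (seq x N) ∣ ℚ.≤ ε
      combine η θ ζ η+η≡ε θ+θ≡η eq 0<ζ C nearx D onset≤D small = N , λ n N≤n → begin
        ℚ.∣ expSum n (seq x n) ℚ.- expSum N (seq x N) ∣
          ≤⟨ ∣-∣-triangle (expSum n (seq x n)) (expSum n (seq x N)) (expSum N (seq x N)) ⟩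
        ℚ.∣ expSum n (seq x n) ℚ.- expSum n (seq x N) ∣ ℚ.+ ℚ.∣ expSum n (seq x N) ℚ.- expSum N (seq x N) ∣
          ≤⟨ ℚP.+-mono-≤ (moved n N≤n) (tail n N≤n) ⟩
        η ℚ.+ η  ≡⟨ η+η≡ε ⟩
        ε        ∎
        where
        N = (A ℕ.⊔ C) ℕ.⊔ D
        A≤N = ℕP.≤-trans (ℕP.m≤m⊔n A C) (ℕP.m≤m⊔n (A ℕ.⊔ C) D)
        C≤N = ℕP.≤-trans (ℕP.m≤n⊔m A C) (ℕP.m≤m⊔n (A ℕ.⊔ C) D)
        D≤N = ℕP.m≤n⊔m (A ℕ.⊔ C) D
        onset≤N = ℕP.≤-trans onset≤D D≤N

        moved : ∀ n → N ℕ.≤ n → ℚ.∣ expSum n (seq x n) ℚ.- expSum n (seq x N) ∣ ℚ.≤ η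
        moved n N≤n = begin
          ℚ.∣ expSum n (seq x n) ℚ.- expSum n (seq x N) ∣
            ≤⟨ expSum-lip (boundx n (ℕP.≤-trans A≤N N≤n)) (boundx N A≤N) n ⟩
          ℚ.∣ seq x n ℚ.- seq x N ∣ ℚ.* expSum n (ℕ→ℚ (suc K))
            ≤⟨ *-mono-nonNeg (ℚP.0≤∣p∣ (seq x n ℚ.- seq x N)) (ℚP.<⇒≤ 0<1+total)
                 (nearx n N (ℕP.≤-trans C≤N N≤n) C≤N)
                 (ℚP.≤-trans (expSum≤total (ℕP.≤-trans onset≤N N≤n)) total≤1+total) ⟩
          ζ ℚ.* (1ℚ ℚ.+ total)
            ≡⟨ trans (ℚP.*-comm ζ (1ℚ ℚ.+ total)) eq ⟩
          η ∎

        tail : ∀ n → N ℕ.≤ n → ℚ.∣ expSum n (seq x N) ℚ.- expSum N (seq x N) ∣ ℚ.≤ η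
        tail n N≤n = begin
          ℚ.∣ expSum n (seq x N) ℚ.- expSum N (seq x N) ∣
            ≤⟨ expSum-tail (boundx N A≤N) onset≤N N≤n ⟩
          expTerm N (ℕ→ℚ (suc K)) ℚ.+ expTerm N (ℕ→ℚ (suc K))
            ≤⟨ ℚP.+-mono-≤ (anti N D≤N) (anti N D≤N) ⟩
          θ ℚ.+ θ  ≡⟨ θ+θ≡η ⟩
          η        ∎
          where
          anti : ∀ n → D ℕ.≤ n → expTerm n (ℕ→ℚ (suc K)) ℚ.≤ θ
          anti n D≤n = ℚP.≤-trans (expTerm-anti onset≤D (ℕP.≤⇒≤′ D≤n)) small

opaque
  fromℚ : ℚ → ℝ
  fromℚ q = mkℝ (const q) (CauchyLemmas.const-cauchy q)

  fromℕ : ℕ → ℝ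
  fromℕ n = fromℚ (ℕ→ℚ n)

  0ℝ 1ℝ : ℝ
  0ℝ = fromℚ 0ℚ
  1ℝ = fromℚ 1ℚ

  _+_ : ℝ → ℝ → ℝ
  x + y = mkℝ (λ n → seq x n ℚ.+ seq y n) (CauchyLemmas.+-cauchy x y)

  _*_ : ℝ → ℝ → ℝ
  x * y = mkℝ (λ n → seq x n ℚ.* seq y n) (CauchyLemmas.*-cauchy x y)

  exp : ℝ → ℝ
  exp x = mkℝ (λ n → expSum n (seq x n)) (CauchyLemmas.exp-cauchy x)

-- Natural logarithm and nonnegative square root, each unique up to _≈_.

IsLog : ℝ → ℝ → Set
IsLog ℓ x = exp ℓ ≈ x

IsSqrt : ℝ → ℝ → Set
IsSqrt s x = 0ℝ ≤ s × s * s ≈ x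

sum : ∀ {n} → Vector ℝ n → ℝ
sum = foldr _+_ 0ℝ

-- Within step t, before t holds the heights at the start, and filled t the
-- intermediate heights after the adversary has poured.

module Heights {n : ℕ} (pour : ℕ → Vector ℝ n) (choice : ℕ → Fin n) where
  mutual
    before : ℕ → Vector ℝ n
    before zero    = const 0ℝ
    before (suc t) = updateAt (filled t) (choice t) (const 0ℝ)

    filled : ℕ → Vector ℝ n
    filled t i = before t i + pour t i

record Play (c : ℝ) (n : ℕ) : Set where
  field
    pour     : ℕ → Vector ℝ n
    estimate : ℕ → Vector ℝ n
    choice   : ℕ → Fin n

  open Heights pour choice public

  field
    pour-nonNeg    : ∀ t i → 0ℝ ≤ pour t i
    pour-unit      : ∀ t → sum (pour t) ≈ 1ℝ
    estimate-lower : ∀ t i → filled t i ≤ estimate t i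
    estimate-upper : ∀ t i → estimate t i ≤ c * filled t i

IsGreedy : ∀ {c n} → Play c n → Set
IsGreedy p = ∀ t i → estimate t i ≤ estimate t (choice t)
  where open Play p

-- The supremum (possibly infinite) of all heights, at the start of a step and
-- after pouring, is at least b exactly when every x < b is exceeded somewhere.
BacklogAtLeast : ∀ {c n} → Play c n → ℝ → Set
BacklogAtLeast p b = ∀ x → x < b → ∃[ t ] ∃[ i ] (x < before t i ⊎ x < filled t i)
  where open Play p

-- With ties broken in the adversary's favour, the cups that greedy empties are
-- determined by what the adversary does, so that an adaptive strategy amounts to
-- one play in which every choice maximises the estimates.

AdversaryAchieves : ℝ → ℕ → ℝ → Set
AdversaryAchieves c n b = Σ[ p ∈ Play c n ] (IsGreedy p × BacklogAtLeast p b)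

{-# OPTIONS --safe #-}

-- Greedy can be made to empty any cup whose height is within a factor μ ≤ c of the
-- maximum. Given (1 + r) a cups at height h, sacrifice all but a of them, one per
-- step: half of the water goes to the cup about to be emptied and half is shared
-- evenly among the a survivors, which end at height h + r/2. Sacrificing works as
-- long as h + r/2 ≤ μ (h + 1/2), so r may grow linearly with h. Hence a bounded
-- number q of such stages doubles the height and divides the number of cups by
-- (1 + r)^q = O(h)^q: reaching height of order 2^k takes at most 2^(q k²) cups.

module Submission where

open import Defs
open import Data.Nat as ℕ using (ℕ; zero; suc) renaming (_≥_ to _≥ℕ_)
import Data.Nat.Properties as ℕP
open import Data.Nat.Tactic.RingSolver using (solve-∀)
import Data.Integer as ℤ
open import Data.Fin as Fin using (Fin; zero; suc; toℕ)
import Data.Fin.Properties as FinP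
open import Data.Rational as ℚ using (ℚ; 0ℚ; 1ℚ; ½)
import Data.Rational.Properties as ℚP
open import Data.Rational.Solver using (module +-*-Solver)
open import Data.Maybe using (Maybe; just; nothing)
open import Data.Product using (_×_; _,_; proj₁; proj₂; ∃-syntax; Σ-syntax)
open import Data.Sum using (inj₁; inj₂)
open import Data.Vec.Functional using (Vector; updateAt)
open import Data.Vec.Functional.Properties using (updateAt-updates; updateAt-minimal)
open import Algebra.Properties.CommutativeMonoid.Sum ℚP.+-0-commutativeMonoid
  using (∑-distrib-+) renaming (sum to ∑)
open import Function using (const)
open import Relation.Nullary using (yes; no; contradiction)
open import Relation.Binary.PropositionalEquality
  using (_≡_; _≢_; refl; sym; trans; cong; cong₂; subst; subst₂; module ≡-Reasoning)
open RationalLemmas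
open +-*-Solver using (solve; _:=_; _:+_; _:*_; _:-_; :-_; con)

private variable
  n : ℕ

-- The game on rational heights

-- The surviving cups always form an initial segment, so every configuration of the strategy is a
-- sum of blocks, and emptying the last cup of a block shortens it by one.
block : ℕ → ℚ → Vector ℚ n
block zero    y j       = 0ℚ
block (suc a) y zero    = y
block (suc a) y (suc j) = block a y j

spike : Fin n → ℚ → Vector ℚ n
spike i y = updateAt (const 0ℚ) i (const y)

∑-zero : ∀ n → ∑ {n} (const 0ℚ) ≡ 0ℚ
∑-zero zero    = refl
∑-zero (suc n) = trans (ℚP.+-identityˡ _) (∑-zero n)

∑-block : ∀ {a} y → a ℕ.≤ n → ∑ (block {n} a y) ≡ ℕ→ℚ a ℚ.* y
∑-block {n} y ℕ.z≤n = trans (∑-zero n) (sym (ℚP.*-zeroˡ y))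
∑-block {suc n} y (ℕ.s≤s {a} a≤n) = begin
  y ℚ.+ ∑ {n} (block a y)   ≡⟨ cong (y ℚ.+_) (∑-block y a≤n) ⟩
  y ℚ.+ ℕ→ℚ a ℚ.* y       ≡⟨ solve 2 (λ y x → y :+ x :* y := (x :+ con 1ℚ) :* y) refl y (ℕ→ℚ a) ⟩
  (ℕ→ℚ a ℚ.+ 1ℚ) ℚ.* y    ≡⟨ cong (ℚ._* y) (sym (ℕ→ℚ-suc a)) ⟩
  ℕ→ℚ (suc a) ℚ.* y       ∎
  where open ≡-Reasoning

∑-spike : (i : Fin n) (y : ℚ) → ∑ (spike i y) ≡ y
∑-spike {suc n} zero    y = trans (cong (y ℚ.+_) (∑-zero n)) (ℚP.+-identityʳ y)
∑-spike         (suc i) y = trans (ℚP.+-identityˡ _) (∑-spike i y)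

block-≡0 : ∀ a (j : Fin n) → block a 0ℚ j ≡ 0ℚ
block-≡0 zero    j       = refl
block-≡0 (suc a) zero    = refl
block-≡0 (suc a) (suc j) = block-≡0 a j

block-+ : ∀ a x y (j : Fin n) → block a (x ℚ.+ y) j ≡ block a x j ℚ.+ block a y j
block-+ zero    x y j       = refl
block-+ (suc a) x y zero    = refl
block-+ (suc a) x y (suc j) = block-+ a x y j

block-out : ∀ {a} y (j : Fin n) → a ℕ.≤ toℕ j → block a y j ≡ 0ℚ
block-out {a = zero}  y j       le         = refl
block-out {a = suc a} y (suc j) (ℕ.s≤s le) = block-out y j le

block-last : ∀ {m} y (j : Fin n) → toℕ j ≡ m → block (suc m) y j ≡ y
block-last y zero    refl = refl
block-last y (suc j) refl = block-last y j refl

block-suc : ∀ {m} y (j : Fin n) → toℕ j ≢ m → block (suc m) y j ≡ block m y j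
block-suc {m = zero}  y zero    ne = contradiction refl ne
block-suc {m = suc m} y zero    ne = refl
block-suc {m = zero}  y (suc j) ne = refl
block-suc {m = suc m} y (suc j) ne = block-suc y j (λ eq → ne (cong suc eq))

block-≥0 : ∀ a {y} → 0ℚ ℚ.≤ y → (j : Fin n) → 0ℚ ℚ.≤ block a y j
block-≥0 zero    0≤y j       = ℚP.≤-refl
block-≥0 (suc a) 0≤y zero    = 0≤y
block-≥0 (suc a) 0≤y (suc j) = block-≥0 a 0≤y j

block-≤ : ∀ a {y} → 0ℚ ℚ.≤ y → (j : Fin n) → block a y j ℚ.≤ y
block-≤ zero    0≤y j       = 0≤y
block-≤ (suc a) 0≤y zero    = ℚP.≤-refl
block-≤ (suc a) 0≤y (suc j) = block-≤ a 0≤y j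

spike-at : (i : Fin n) (y : ℚ) → spike i y i ≡ y
spike-at i y = updateAt-updates i (const 0ℚ)

spike-off : (i : Fin n) (y : ℚ) {j : Fin n} → j ≢ i → spike i y j ≡ 0ℚ
spike-off i y {j} j≢i = updateAt-minimal j i (const 0ℚ) j≢i

spike-≥0 : (i : Fin n) {y : ℚ} → 0ℚ ℚ.≤ y → ∀ j → 0ℚ ℚ.≤ spike i y j
spike-≥0 zero    0≤y zero    = 0≤y
spike-≥0 zero    0≤y (suc j) = ℚP.≤-refl
spike-≥0 (suc i) 0≤y zero    = ℚP.≤-refl
spike-≥0 (suc i) 0≤y (suc j) = spike-≥0 i 0≤y j

argmax : (v : Vector ℚ (suc n)) → ∃[ i ] ∀ j → v j ℚ.≤ v i
argmax {zero}  v = zero , λ { zero → ℚP.≤-refl }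
argmax {suc n} v with argmax (λ j → v (suc j))
... | i , max with ℚP.≤-total (v zero) (v (suc i))
...   | inj₁ le = suc i , λ { zero → le ; (suc j) → max j }
...   | inj₂ ge = zero  , λ { zero → ℚP.≤-refl ; (suc j) → ℚP.≤-trans (max j) ge }

-- Moves and winning strategies

NonNeg : Vector ℚ n → Set
NonNeg v = ∀ j → 0ℚ ℚ.≤ v j

-- Inflating the estimate of the emptied cup by μ makes greedy empty any cup whose
-- height is at least 1/μ of the maximum.

record Move (μ : ℚ) {n : ℕ} (v : Vector ℚ n) : Set where
  field
    pour        : Vector ℚ n
    choice      : Fin n
    pour-nonNeg : NonNeg pour
    pour-unit   : ∑ pour ≡ 1ℚ

  filled : Vector ℚ n
  filled j = v j ℚ.+ pour j

  field
    deceptive   : ∀ j → filled j ℚ.≤ μ ℚ.* filled choice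

  after : Vector ℚ n
  after = updateAt filled choice (const 0ℚ)

updateAt-cong : ∀ {f g : Vector ℚ n} i {y} → (∀ j → f j ≡ g j) →
                ∀ j → updateAt f i (const y) j ≡ updateAt g i (const y) j
updateAt-cong zero    eq zero    = refl
updateAt-cong zero    eq (suc j) = eq (suc j)
updateAt-cong (suc i) eq zero    = eq zero
updateAt-cong (suc i) eq (suc j) = updateAt-cong i (λ j → eq (suc j)) j

-- Greedy's choice is settled within each move, so a strategy does not branch: a win is a finite
-- list of moves.
data Win (μ H : ℚ) {n : ℕ} (v : Vector ℚ n) : Set where
  done : ∀ i → H ℚ.≤ v i → Win μ H v
  move : (m : Move μ v) → Win μ H (Move.after m) → Win μ H v

module _ {μ H : ℚ} where

  -- Height vectors are functions and configurations agree only pointwise, so wins have to be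
  -- transported along pointwise equality.
  Win-cong : {v w : Vector ℚ n} → (∀ j → v j ≡ w j) → Win μ H v → Win μ H w
  Win-cong v≗w (done i le) = done i (subst (H ℚ.≤_) (v≗w i) le)
  Win-cong {v = v} {w} v≗w (move m win) =
    move m′ (Win-cong (updateAt-cong choice filled≗) win)
    where
    open Move m
    filled≗ : ∀ j → v j ℚ.+ pour j ≡ w j ℚ.+ pour j
    filled≗ j = cong (ℚ._+ pour j) (v≗w j)
    m′ : Move μ w
    m′ = record
      { pour = pour ; choice = choice ; pour-nonNeg = pour-nonNeg ; pour-unit = pour-unit
      ; deceptive = λ j → subst₂ ℚ._≤_ (filled≗ j) (cong (μ ℚ.*_) (filled≗ choice)) (deceptive j) }

  -- Here `h` is the common height when a stage begins, `g` the amount that each of the `a`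
  -- survivors receives per step, and `y` below their surplus over `h` so far.
  module _ {a : ℕ} {h g : ℚ} (0≤h : 0ℚ ℚ.≤ h) (0≤g : 0ℚ ℚ.≤ g) (1≤μ : 1ℚ ℚ.≤ μ)
           (a*g : ℕ→ℚ a ℚ.* g ≡ ½) where

    -- One step: cup a + t is filled by ½ and emptied, the other ½ is shared among the
    -- first a cups.

    sacrifice : ∀ {t y} → suc (a ℕ.+ t) ℕ.≤ n → 0ℚ ℚ.≤ y → h ℚ.+ (y ℚ.+ g) ℚ.≤ μ ℚ.* (h ℚ.+ ½) →
                Win μ H {n} (λ j → block (a ℕ.+ t) h j ℚ.+ block a (y ℚ.+ g) j) →
                Win μ H {n} (λ j → block (suc (a ℕ.+ t)) h j ℚ.+ block a y j)
    sacrifice {n} {t} {y} lt 0≤y ok win = move m (Win-cong after≗ win)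
      where
      b : Fin n
      b = Fin.fromℕ< lt

      toℕ-b : toℕ b ≡ a ℕ.+ t
      toℕ-b = FinP.toℕ-fromℕ< lt

      a≤b : a ℕ.≤ toℕ b
      a≤b = subst (a ℕ.≤_) (sym toℕ-b) (ℕP.m≤m+n a t)

      0≤½ : 0ℚ ℚ.≤ ½
      0≤½ = ℚP.nonNegative⁻¹ ½

      pour filled : Vector ℚ n
      pour j = spike b ½ j ℚ.+ block a g j
      filled j = (block (suc (a ℕ.+ t)) h j ℚ.+ block a y j) ℚ.+ pour j

      filled-at : filled b ≡ h ℚ.+ ½
      filled-at = trans
        (cong₂ ℚ._+_ (cong₂ ℚ._+_ (block-last h b toℕ-b) (block-out y b a≤b))
                     (cong₂ ℚ._+_ (spike-at b ½) (block-out g b a≤b)))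
        (cong₂ ℚ._+_ (ℚP.+-identityʳ h) (ℚP.+-identityʳ ½))

      filled-off : ∀ {j} → j ≢ b → filled j ≡ block (a ℕ.+ t) h j ℚ.+ block a (y ℚ.+ g) j
      filled-off {j} j≢b = begin
        (block (suc (a ℕ.+ t)) h j ℚ.+ block a y j) ℚ.+ (spike b ½ j ℚ.+ block a g j)
          ≡⟨ cong₂ (λ p q → (p ℚ.+ block a y j) ℚ.+ (q ℚ.+ block a g j))
               (block-suc h j (λ eq → j≢b (FinP.toℕ-injective (trans eq (sym toℕ-b)))))
               (spike-off b ½ j≢b) ⟩
        (block (a ℕ.+ t) h j ℚ.+ block a y j) ℚ.+ (0ℚ ℚ.+ block a g j)
          ≡⟨ cong ((block (a ℕ.+ t) h j ℚ.+ block a y j) ℚ.+_) (ℚP.+-identityˡ (block a g j)) ⟩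
        (block (a ℕ.+ t) h j ℚ.+ block a y j) ℚ.+ block a g j
          ≡⟨ ℚP.+-assoc (block (a ℕ.+ t) h j) (block a y j) (block a g j) ⟩
        block (a ℕ.+ t) h j ℚ.+ (block a y j ℚ.+ block a g j)
          ≡⟨ cong (block (a ℕ.+ t) h j ℚ.+_) (sym (block-+ a y g j)) ⟩
        block (a ℕ.+ t) h j ℚ.+ block a (y ℚ.+ g) j ∎
        where open ≡-Reasoning

      0≤h+½ : 0ℚ ℚ.≤ h ℚ.+ ½
      0≤h+½ = ℚP.+-mono-≤ 0≤h 0≤½

      deceptive : ∀ j → filled j ℚ.≤ μ ℚ.* filled b
      deceptive j with j FinP.≟ b
      ... | yes refl = begin
        filled b                 ≡⟨ filled-at ⟩
        h ℚ.+ ½                  ≡⟨ sym (ℚP.*-identityˡ (h ℚ.+ ½)) ⟩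
        1ℚ ℚ.* (h ℚ.+ ½)         ≤⟨ ℚP.*-monoʳ-≤-nonNeg (h ℚ.+ ½) {{ℚ.nonNegative 0≤h+½}} 1≤μ ⟩
        μ ℚ.* (h ℚ.+ ½)          ≡⟨ cong (μ ℚ.*_) (sym filled-at) ⟩
        μ ℚ.* filled b           ∎
        where open ℚP.≤-Reasoning
      -- No other cup rises above the survivors' level `h + (y + g)`, which `ok` compares with the
      -- emptied cup.
      ... | no j≢b = begin
        filled j                                           ≡⟨ filled-off j≢b ⟩
        block (a ℕ.+ t) h j ℚ.+ block a (y ℚ.+ g) j        ≤⟨ ℚP.+-mono-≤ (block-≤ (a ℕ.+ t) 0≤h j)
                                                                (block-≤ a (ℚP.+-mono-≤ 0≤y 0≤g) j) ⟩
        h ℚ.+ (y ℚ.+ g)                                    ≤⟨ ok ⟩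
        μ ℚ.* (h ℚ.+ ½)                                    ≡⟨ cong (μ ℚ.*_) (sym filled-at) ⟩
        μ ℚ.* filled b                                     ∎
        where open ℚP.≤-Reasoning

      m : Move μ (λ j → block (suc (a ℕ.+ t)) h j ℚ.+ block a y j)
      m = record
        { pour = pour
        ; choice = b
        ; pour-nonNeg = λ j → ℚP.+-mono-≤ (spike-≥0 b 0≤½ j) (block-≥0 a 0≤g j)
        ; pour-unit = trans (∑-distrib-+ (spike b ½) (block a g))
            (cong₂ ℚ._+_ (∑-spike b ½)
              (trans (∑-block g (ℕP.≤-trans a≤b (FinP.toℕ≤n b))) a*g))
        ; deceptive = deceptive
        }

      after≗ : ∀ j → block (a ℕ.+ t) h j ℚ.+ block a (y ℚ.+ g) j ≡ Move.after m j
      after≗ j with j FinP.≟ b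
      ... | yes refl = trans
        (cong₂ ℚ._+_ (block-out h b (ℕP.≤-reflexive (sym toℕ-b))) (block-out (y ℚ.+ g) b a≤b))
        (sym (updateAt-updates b filled))
      ... | no j≢b = trans (sym (filled-off j≢b)) (sym (updateAt-minimal j b filled j≢b))

    -- Induction on the number `t` of cups still to be sacrificed. The survivors only rise, so the
    -- condition at their final height implies the condition at every step.
    drain : ∀ t {y} → a ℕ.+ t ℕ.≤ n → 0ℚ ℚ.≤ y → h ℚ.+ (y ℚ.+ ℕ→ℚ t ℚ.* g) ℚ.≤ μ ℚ.* (h ℚ.+ ½) →
            Win μ H {n} (block a (h ℚ.+ (y ℚ.+ ℕ→ℚ t ℚ.* g))) →
            Win μ H {n} (λ j → block (a ℕ.+ t) h j ℚ.+ block a y j)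
    drain zero {y} le 0≤y ok = Win-cong λ j → trans (block-+ a h _ j)
      (cong₂ (λ m z → block m h j ℚ.+ block a z j) (sym (ℕP.+-identityʳ a))
        (trans (cong (y ℚ.+_) (ℚP.*-zeroˡ g)) (ℚP.+-identityʳ y)))
    drain {n} (suc t) {y} le 0≤y ok win =
      Win-cong (λ j → cong (λ m → block m h j ℚ.+ block a y j) (sym (ℕP.+-suc a t)))
        (sacrifice {t = t} le′ 0≤y (ℚP.≤-trans (ℚP.+-monoʳ-≤ h y+g≤) ok)
          (drain t (ℕP.<⇒≤ le′) (ℚP.+-mono-≤ 0≤y 0≤g)
            (subst (λ z → h ℚ.+ z ℚ.≤ μ ℚ.* (h ℚ.+ ½)) shift ok)
            (Win-cong (λ j → cong (λ z → block a (h ℚ.+ z) j) shift) win)))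
      where
      le′ : suc (a ℕ.+ t) ℕ.≤ n
      le′ = subst (ℕ._≤ n) (ℕP.+-suc a t) le

      shift : y ℚ.+ ℕ→ℚ (suc t) ℚ.* g ≡ (y ℚ.+ g) ℚ.+ ℕ→ℚ t ℚ.* g
      shift = trans (cong (λ z → y ℚ.+ z ℚ.* g) (ℕ→ℚ-suc t))
        (solve 3 (λ y x g → y :+ (x :+ con 1ℚ) :* g := (y :+ g) :+ x :* g) refl y (ℕ→ℚ t) g)

      y+g≤ : y ℚ.+ g ℚ.≤ y ℚ.+ ℕ→ℚ (suc t) ℚ.* g
      y+g≤ = begin
        y ℚ.+ g                      ≡⟨ sym (ℚP.+-identityʳ (y ℚ.+ g)) ⟩
        (y ℚ.+ g) ℚ.+ 0ℚ             ≤⟨ ℚP.+-monoʳ-≤ (y ℚ.+ g) (0≤* (0≤ℕ→ℚ t) 0≤g) ⟩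
        (y ℚ.+ g) ℚ.+ ℕ→ℚ t ℚ.* g    ≡⟨ sym shift ⟩
        y ℚ.+ ℕ→ℚ (suc t) ℚ.* g      ∎
        where open ℚP.≤-Reasoning

-- Stages and levels

ℕ→ℚ-+ : ∀ m n → ℕ→ℚ (m ℕ.+ n) ≡ ℕ→ℚ m ℚ.+ ℕ→ℚ n
ℕ→ℚ-+ zero    n = sym (ℚP.+-identityˡ _)
ℕ→ℚ-+ (suc m) n = begin
  ℕ→ℚ (suc (m ℕ.+ n))             ≡⟨ ℕ→ℚ-suc (m ℕ.+ n) ⟩
  ℕ→ℚ (m ℕ.+ n) ℚ.+ 1ℚ            ≡⟨ cong (ℚ._+ 1ℚ) (ℕ→ℚ-+ m n) ⟩
  (ℕ→ℚ m ℚ.+ ℕ→ℚ n) ℚ.+ 1ℚ        ≡⟨ solve 2 (λ x y → (x :+ y) :+ con 1ℚ := (x :+ con 1ℚ) :+ y) refl (ℕ→ℚ m) (ℕ→ℚ n) ⟩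
  (ℕ→ℚ m ℚ.+ 1ℚ) ℚ.+ ℕ→ℚ n        ≡⟨ cong (ℚ._+ ℕ→ℚ n) (sym (ℕ→ℚ-suc m)) ⟩
  ℕ→ℚ (suc m) ℚ.+ ℕ→ℚ n           ∎
  where open ≡-Reasoning

ℕ→ℚ-* : ∀ m n → ℕ→ℚ (m ℕ.* n) ≡ ℕ→ℚ m ℚ.* ℕ→ℚ n
ℕ→ℚ-* zero    n = sym (ℚP.*-zeroˡ (ℕ→ℚ n))
ℕ→ℚ-* (suc m) n = begin
  ℕ→ℚ (n ℕ.+ m ℕ.* n)             ≡⟨ ℕ→ℚ-+ n (m ℕ.* n) ⟩
  ℕ→ℚ n ℚ.+ ℕ→ℚ (m ℕ.* n)         ≡⟨ cong (ℕ→ℚ n ℚ.+_) (ℕ→ℚ-* m n) ⟩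
  ℕ→ℚ n ℚ.+ ℕ→ℚ m ℚ.* ℕ→ℚ n       ≡⟨ solve 2 (λ x y → y :+ x :* y := (x :+ con 1ℚ) :* y) refl (ℕ→ℚ m) (ℕ→ℚ n) ⟩
  (ℕ→ℚ m ℚ.+ 1ℚ) ℚ.* ℕ→ℚ n        ≡⟨ cong (ℚ._* ℕ→ℚ n) (sym (ℕ→ℚ-suc m)) ⟩
  ℕ→ℚ (suc m) ℚ.* ℕ→ℚ n           ∎
  where open ≡-Reasoning

double-half : ∀ p → p ℚ.* ½ ℚ.+ p ℚ.* ½ ≡ p
double-half p = trans (sym (ℚP.*-distribˡ-+ p ½ ½)) (ℚP.*-identityʳ p)

ℕ→ℚ-2^suc : ∀ k → ℕ→ℚ (2 ℕ.^ suc k) ≡ ℕ→ℚ (2 ℕ.^ k) ℚ.+ ℕ→ℚ (2 ℕ.^ k)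
ℕ→ℚ-2^suc k = trans (cong (λ m → ℕ→ℚ (2 ℕ.^ k ℕ.+ m)) (ℕP.+-identityʳ (2 ℕ.^ k))) (ℕ→ℚ-+ (2 ℕ.^ k) (2 ℕ.^ k))

p≤p+q : ∀ {p q} → 0ℚ ℚ.≤ q → p ℚ.≤ p ℚ.+ q
p≤p+q {p} 0≤q = ℚP.≤-trans (ℚP.≤-reflexive (sym (ℚP.+-identityʳ p))) (ℚP.+-monoʳ-≤ p 0≤q)

q≤p+q : ∀ {p q} → 0ℚ ℚ.≤ p → q ℚ.≤ p ℚ.+ q
q≤p+q {p} {q} 0≤p = ℚP.≤-trans (ℚP.≤-reflexive (sym (ℚP.+-identityˡ q))) (ℚP.+-monoˡ-≤ q 0≤p)

-- Of the `a * suc r` cups, `a * r` are sacrificed; each step gives every survivor 1/(2a), for a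
-- total rise of r/2.
stage : ∀ {μ H h} a {{_ : ℕ.NonZero a}} r → 0ℚ ℚ.≤ h → 1ℚ ℚ.≤ μ →
        h ℚ.+ ℕ→ℚ r ℚ.* ½ ℚ.≤ μ ℚ.* (h ℚ.+ ½) → a ℕ.* suc r ℕ.≤ n →
        Win μ H {n} (block a (h ℚ.+ ℕ→ℚ r ℚ.* ½)) → Win μ H {n} (block (a ℕ.* suc r) h)
stage {n} {μ} {H} {h} (suc a) r 0≤h 1≤μ ok fits win =
  Win-cong (λ j → trans (cong₂ ℚ._+_ (cong (λ m → block m h j) size) (block-≡0 (suc a) j))
                        (ℚP.+-identityʳ _))
    (drain {h = h} {g = g} 0≤h 0≤g 1≤μ a*g (suc a ℕ.* r) {0ℚ}
      (subst (ℕ._≤ n) (sym size) fits) ℚP.≤-refl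
      (subst (λ z → h ℚ.+ z ℚ.≤ μ ℚ.* (h ℚ.+ ½)) (sym rise) ok)
      (Win-cong (λ j → cong (λ z → block (suc a) (h ℚ.+ z) j) (sym rise)) win))
  where
  size : suc a ℕ.+ suc a ℕ.* r ≡ suc a ℕ.* suc r
  size = sym (ℕP.*-suc (suc a) r)

  share = scale (0<ℕ→ℚ-suc a) (ℚP.positive⁻¹ ½)
  g = proj₁ share

  0≤g : 0ℚ ℚ.≤ g
  0≤g = ℚP.<⇒≤ (proj₁ (proj₂ share))

  a*g : ℕ→ℚ (suc a) ℚ.* g ≡ ½
  a*g = proj₂ (proj₂ share)

  rise : 0ℚ ℚ.+ ℕ→ℚ (suc a ℕ.* r) ℚ.* g ≡ ℕ→ℚ r ℚ.* ½
  rise = begin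
    0ℚ ℚ.+ ℕ→ℚ (suc a ℕ.* r) ℚ.* g     ≡⟨ ℚP.+-identityˡ _ ⟩
    ℕ→ℚ (suc a ℕ.* r) ℚ.* g            ≡⟨ cong (ℚ._* g) (ℕ→ℚ-* (suc a) r) ⟩
    (ℕ→ℚ (suc a) ℚ.* ℕ→ℚ r) ℚ.* g      ≡⟨ solve 3 (λ a r g → (a :* r) :* g := r :* (a :* g)) refl (ℕ→ℚ (suc a)) (ℕ→ℚ r) g ⟩
    ℕ→ℚ r ℚ.* (ℕ→ℚ (suc a) ℚ.* g)      ≡⟨ cong (ℕ→ℚ r ℚ.*_) a*g ⟩
    ℕ→ℚ r ℚ.* ½                        ∎
    where open ≡-Reasoning

module Climb {ε : ℚ} (0<ε : 0ℚ ℚ.< ε) (q : ℕ) (1≤qε : 1ℚ ℚ.≤ ℕ→ℚ q ℚ.* ε) where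

  μ : ℚ
  μ = 1ℚ ℚ.+ ε

  0≤ε : 0ℚ ℚ.≤ ε
  0≤ε = ℚP.<⇒≤ 0<ε

  1≤μ : 1ℚ ℚ.≤ μ
  1≤μ = p≤p+q 0≤ε

  -- A stage requires r ≤ 2εh + 1 + ε. The hypothesis `slow`, r ≤ 2εh + 1, implies this and persists
  -- as h grows, so the same `r` serves all `i` stages.
  repeat : ∀ {H h} a {{_ : ℕ.NonZero a}} r i → 0ℚ ℚ.≤ h → ℕ→ℚ r ℚ.≤ ε ℚ.* (h ℚ.+ h) ℚ.+ 1ℚ →
           a ℕ.* suc r ℕ.^ i ℕ.≤ n →
           Win μ H {n} (block a (h ℚ.+ ℕ→ℚ i ℚ.* (ℕ→ℚ r ℚ.* ½))) →
           Win μ H {n} (block (a ℕ.* suc r ℕ.^ i) h)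
  repeat {h = h} a r zero 0≤h slow fits =
    Win-cong λ j → cong₂ (λ m x → block m x j) (sym (ℕP.*-identityʳ a))
      (trans (cong (h ℚ.+_) (ℚP.*-zeroˡ (ℕ→ℚ r ℚ.* ½))) (ℚP.+-identityʳ h))
  repeat {n} {h = h} a {{nz-a}} r (suc i) 0≤h slow fits win =
    Win-cong (λ j → cong (λ m → block m h j) size)
      -- The first stage keeps exactly the cups that the remaining `i` stages start from.
      (stage (a ℕ.* suc r ℕ.^ i) {{nz}} r 0≤h 1≤μ ok fits′
        (repeat a r i 0≤h′ slow′ (ℕP.≤-trans (ℕP.m≤m*n _ (suc r)) fits′)
          (Win-cong (λ j → cong (λ x → block a x j) rise) win)))
    where
    d : ℚ
    d = ℕ→ℚ r ℚ.* ½

    nz : ℕ.NonZero (a ℕ.* suc r ℕ.^ i)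
    nz = ℕP.m*n≢0 a (suc r ℕ.^ i) {{nz-a}} {{ℕP.m^n≢0 (suc r) i}}

    size : (a ℕ.* suc r ℕ.^ i) ℕ.* suc r ≡ a ℕ.* suc r ℕ.^ suc i
    size = trans (ℕP.*-assoc a _ (suc r)) (cong (a ℕ.*_) (ℕP.*-comm (suc r ℕ.^ i) (suc r)))

    fits′ : (a ℕ.* suc r ℕ.^ i) ℕ.* suc r ℕ.≤ n
    fits′ = subst (ℕ._≤ n) (sym size) fits

    0≤d : 0ℚ ℚ.≤ d
    0≤d = 0≤* (0≤ℕ→ℚ r) (ℚP.nonNegative⁻¹ ½)

    0≤h′ : 0ℚ ℚ.≤ h ℚ.+ d
    0≤h′ = ℚP.+-mono-≤ 0≤h 0≤d

    slow′ : ℕ→ℚ r ℚ.≤ ε ℚ.* ((h ℚ.+ d) ℚ.+ (h ℚ.+ d)) ℚ.+ 1ℚ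
    slow′ = ℚP.≤-trans slow (ℚP.+-monoˡ-≤ 1ℚ
      (ℚP.*-monoˡ-≤-nonNeg ε {{ℚ.nonNegative 0≤ε}} (ℚP.+-mono-≤ {h} (p≤p+q 0≤d) (p≤p+q 0≤d))))

    rise : h ℚ.+ ℕ→ℚ (suc i) ℚ.* d ≡ (h ℚ.+ d) ℚ.+ ℕ→ℚ i ℚ.* d
    rise = trans (cong (λ z → h ℚ.+ z ℚ.* d) (ℕ→ℚ-suc i))
      (solve 3 (λ h x d → h :+ (x :+ con 1ℚ) :* d := (h :+ d) :+ x :* d) refl h (ℕ→ℚ i) d)

    ok : h ℚ.+ d ℚ.≤ μ ℚ.* (h ℚ.+ ½)
    ok = begin
      h ℚ.+ ℕ→ℚ r ℚ.* ½
        ≤⟨ ℚP.+-monoʳ-≤ h (ℚP.*-monoʳ-≤-nonNeg ½ slow) ⟩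
      h ℚ.+ (ε ℚ.* (h ℚ.+ h) ℚ.+ 1ℚ) ℚ.* ½
        ≤⟨ p≤p+q (0≤* 0≤ε (ℚP.nonNegative⁻¹ ½)) ⟩
      (h ℚ.+ (ε ℚ.* (h ℚ.+ h) ℚ.+ 1ℚ) ℚ.* ½) ℚ.+ ε ℚ.* ½
        ≡⟨ solve 2 (λ h e → (h :+ (e :* (h :+ h) :+ con 1ℚ) :* con ½) :+ e :* con ½
                              := (con 1ℚ :+ e) :* (h :+ con ½)) refl h ε ⟩
      (1ℚ ℚ.+ ε) ℚ.* (h ℚ.+ ½) ∎
      where open ℚP.≤-Reasoning

  -- Level k consists of q stages, each raising the surviving cups by 2ᵏ/2; the
  -- number of cups divides by 1 + 2ᵏ in every stage.

  height : ℕ → ℚ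
  height zero    = 0ℚ
  height (suc k) = height k ℚ.+ ℕ→ℚ q ℚ.* (ℕ→ℚ (2 ℕ.^ k) ℚ.* ½)

  need : ℕ → ℕ
  need zero    = 1
  need (suc k) = suc (2 ℕ.^ k) ℕ.^ q ℕ.* need k

  gain≥0 : ∀ k → 0ℚ ℚ.≤ ℕ→ℚ q ℚ.* (ℕ→ℚ (2 ℕ.^ k) ℚ.* ½)
  gain≥0 k = 0≤* (0≤ℕ→ℚ q) (0≤* (0≤ℕ→ℚ (2 ℕ.^ k)) (ℚP.nonNegative⁻¹ ½))

  height-≥0 : ∀ k → 0ℚ ℚ.≤ height k
  height-≥0 zero    = ℚP.≤-refl
  height-≥0 (suc k) = ℚP.+-mono-≤ (height-≥0 k) (gain≥0 k)

  -- Passing to the next level adds 2^k on the left and 2ε · q · 2^k/2 = qε · 2^k on the right, so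
  -- the choice qε ≥ 1 preserves the inequality.
  height-slow : ∀ k → ℕ→ℚ (2 ℕ.^ k) ℚ.≤ ε ℚ.* (height k ℚ.+ height k) ℚ.+ 1ℚ
  height-slow zero    = ℚP.≤-reflexive (sym (trans (cong (ℚ._+ 1ℚ) (ℚP.*-zeroʳ ε)) (ℚP.+-identityˡ 1ℚ)))
  height-slow (suc k) = begin
    ℕ→ℚ (2 ℕ.^ suc k)
      ≡⟨ ℕ→ℚ-2^suc k ⟩
    p ℚ.+ p
      ≤⟨ ℚP.+-mono-≤ (height-slow k)
           (ℚP.≤-trans (ℚP.≤-reflexive (sym (ℚP.*-identityˡ p)))
             (ℚP.*-monoʳ-≤-nonNeg p {{ℚ.nonNegative (0≤ℕ→ℚ (2 ℕ.^ k))}} 1≤qε)) ⟩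
    (ε ℚ.* (h ℚ.+ h) ℚ.+ 1ℚ) ℚ.+ (ℕ→ℚ q ℚ.* ε) ℚ.* p
      ≡⟨ solve 4 (λ e h q p → (e :* (h :+ h) :+ con 1ℚ) :+ (q :* e) :* p
                     := e :* ((h :+ q :* (p :* con ½)) :+ (h :+ q :* (p :* con ½))) :+ con 1ℚ)
           refl ε h (ℕ→ℚ q) p ⟩
    ε ℚ.* (height (suc k) ℚ.+ height (suc k)) ℚ.+ 1ℚ ∎
    where
    open ℚP.≤-Reasoning
    p = ℕ→ℚ (2 ℕ.^ k)
    h = height k

  need≢0 : ∀ k → ℕ.NonZero (need k)
  need≢0 zero    = _
  need≢0 (suc k) = ℕP.m*n≢0 _ (need k) {{ℕP.m^n≢0 (suc (2 ℕ.^ k)) q}} {{need≢0 k}}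

  -- The number `a` of cups left at the end is general because the recursion descends through the
  -- levels: to have `a` cups after a level, one starts it with a · (1 + 2^k)^q.
  climb : ∀ {H} k a {{_ : ℕ.NonZero a}} → a ℕ.* need k ℕ.≤ n →
          Win μ H {n} (block a (height k)) → Win μ H {n} (const 0ℚ)
  climb zero    a fits win = Win-cong (block-≡0 a) win
  climb {n} (suc k) a {{nz}} fits win =
    climb k (a ℕ.* suc (2 ℕ.^ k) ℕ.^ q) {{ℕP.m*n≢0 a _ {{nz}} {{ℕP.m^n≢0 (suc (2 ℕ.^ k)) q}}}} fits′
      (repeat a (2 ℕ.^ k) q (height-≥0 k) (height-slow k)
        (ℕP.≤-trans (ℕP.m≤m*n _ (need k) {{need≢0 k}}) fits′) win)
    where
    fits′ : (a ℕ.* suc (2 ℕ.^ k) ℕ.^ q) ℕ.* need k ℕ.≤ n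
    fits′ = subst (ℕ._≤ n) (sym (ℕP.*-assoc a _ (need k))) fits

  climb-zero : ∀ k → need k ℕ.≤ n → Win μ (height k) {n} (const 0ℚ)
  climb-zero {zero} k fits with () ← ℕP.≤-trans (ℕ.>-nonZero⁻¹ (need k) {{need≢0 k}}) fits
  climb-zero {suc n} k fits = climb k 1 (subst (ℕ._≤ suc n) (sym (ℕP.*-identityˡ (need k))) fits)
    (done zero ℚP.≤-refl)

  -- Since 1 + 2^k ≤ 2^(k+1), level k adds at most q(k + 1) to the exponent, and k + 1 + k² ≤ (k +
  -- 1)².
  need-bound : ∀ k → need k ℕ.≤ 2 ℕ.^ (q ℕ.* (k ℕ.* k))
  need-bound zero    = ℕP.m^n>0 2 (q ℕ.* 0)
  need-bound (suc k) = begin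
    suc (2 ℕ.^ k) ℕ.^ q ℕ.* need k
      ≤⟨ ℕP.*-mono-≤ (ℕP.^-monoˡ-≤ q two) (need-bound k) ⟩
    (2 ℕ.^ suc k) ℕ.^ q ℕ.* 2 ℕ.^ (q ℕ.* (k ℕ.* k))
      ≡⟨ cong (ℕ._* 2 ℕ.^ (q ℕ.* (k ℕ.* k))) (trans (ℕP.^-*-assoc 2 (suc k) q) (cong (2 ℕ.^_) (ℕP.*-comm (suc k) q))) ⟩
    2 ℕ.^ (q ℕ.* suc k) ℕ.* 2 ℕ.^ (q ℕ.* (k ℕ.* k))
      ≡⟨ sym (ℕP.^-distribˡ-+-* 2 (q ℕ.* suc k) (q ℕ.* (k ℕ.* k))) ⟩
    2 ℕ.^ (q ℕ.* suc k ℕ.+ q ℕ.* (k ℕ.* k))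
      ≡⟨ cong (2 ℕ.^_) (sym (ℕP.*-distribˡ-+ q (suc k) (k ℕ.* k))) ⟩
    2 ℕ.^ (q ℕ.* (suc k ℕ.+ k ℕ.* k))
      ≤⟨ ℕP.^-monoʳ-≤ 2 (ℕP.*-monoʳ-≤ q (ℕP.+-monoʳ-≤ (suc k) (ℕP.*-monoʳ-≤ k (ℕP.n≤1+n k)))) ⟩
    2 ℕ.^ (q ℕ.* (suc k ℕ.* suc k)) ∎
    where
    open ℕP.≤-Reasoning
    two : suc (2 ℕ.^ k) ℕ.≤ 2 ℕ.^ suc k
    two = subst (suc (2 ℕ.^ k) ℕ.≤_) (cong (2 ℕ.^ k ℕ.+_) (sym (ℕP.+-identityʳ _)))
      (ℕP.+-monoˡ-≤ (2 ℕ.^ k) (ℕP.m^n>0 2 k))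

  -- The last level alone raises the cups by q · 2^(k+1)/2 ≥ 2^k.
  height-bound : 1 ℕ.≤ q → ∀ k → ℕ→ℚ (2 ℕ.^ k) ℚ.≤ height (suc (suc k))
  height-bound 1≤q k = begin
    p                                           ≡⟨ sym (double-half p) ⟩
    p ℚ.* ½ ℚ.+ p ℚ.* ½                         ≡⟨ sym (ℚP.*-distribʳ-+ ½ p p) ⟩
    (p ℚ.+ p) ℚ.* ½                             ≡⟨ cong (ℚ._* ½) (sym (ℕ→ℚ-2^suc k)) ⟩
    P ℚ.* ½                                     ≡⟨ sym (ℚP.*-identityˡ (P ℚ.* ½)) ⟩
    1ℚ ℚ.* (P ℚ.* ½)                            ≤⟨ ℚP.*-monoʳ-≤-nonNeg (P ℚ.* ½)
                                                     {{ℚ.nonNegative (0≤* (0≤ℕ→ℚ (2 ℕ.^ suc k)) (ℚP.nonNegative⁻¹ ½))}}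
                                                     (ℕ→ℚ-mono 1≤q) ⟩
    ℕ→ℚ q ℚ.* (P ℚ.* ½)                         ≤⟨ q≤p+q (height-≥0 (suc k)) ⟩
    height (suc (suc k))                        ∎
    where
    open ℚP.≤-Reasoning
    p = ℕ→ℚ (2 ℕ.^ k)
    P = ℕ→ℚ (2 ℕ.^ suc k)

-- From rational moves to plays

Eventually : (ℕ → Set) → Set
Eventually P = ∃[ N ] ∀ k → N ℕ.≤ k → P k

-- The real operations are unfolded only here; everything later reaches the approximating sequences
-- through these equations.
opaque
  unfolding _≈_ _≤_ _<_ fromℚ _+_ _*_ exp

  seq-fromℚ : ∀ q k → seq (fromℚ q) k ≡ q
  seq-fromℚ q k = refl

  seq-fromℕ : ∀ n k → seq (fromℕ n) k ≡ ℕ→ℚ n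
  seq-fromℕ n k = refl

  seq-0ℝ : ∀ k → seq 0ℝ k ≡ 0ℚ
  seq-0ℝ k = refl

  seq-1ℝ : ∀ k → seq 1ℝ k ≡ 1ℚ
  seq-1ℝ k = refl

  seq-+ : ∀ x y k → seq (x + y) k ≡ seq x k ℚ.+ seq y k
  seq-+ x y k = refl

  seq-* : ∀ x y k → seq (x * y) k ≡ seq x k ℚ.* seq y k
  seq-* x y k = refl

  seq-exp : ∀ x k → seq (exp x) k ≡ expSum k (seq x k)
  seq-exp x k = refl

  ≈-elim : ∀ {x y} → x ≈ y → ∀ ε → 0ℚ ℚ.< ε → Eventually λ k → ℚ.∣ seq x k ℚ.- seq y k ∣ ℚ.≤ ε
  ≈-elim x≈y = x≈y

  ≈-intro : ∀ {x y} → (∀ k → seq x k ≡ seq y k) → x ≈ y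
  ≈-intro {x} {y} eq ε 0<ε = 0 , λ k _ → ℚP.≤-trans
    (ℚP.≤-reflexive (trans (cong (λ p → ℚ.∣ p ℚ.- seq y k ∣) (eq k)) (∣p-p∣≡0 (seq y k)))) (ℚP.<⇒≤ 0<ε)

  ≤-intro : ∀ {x y} → (Eventually λ k → seq x k ℚ.≤ seq y k) → x ≤ y
  ≤-intro {x} {y} (N , le) ε 0<ε = N , λ k N≤k → ℚP.≤-trans (le k N≤k)
    (ℚP.≤-trans (ℚP.≤-reflexive (sym (ℚP.+-identityʳ (seq y k)))) (ℚP.+-monoʳ-≤ (seq y k) (ℚP.<⇒≤ 0<ε)))

  <-elim : ∀ {x y} → x < y → ∃[ ε ] (0ℚ ℚ.< ε × (Eventually λ k → seq x k ℚ.+ ε ℚ.≤ seq y k))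
  <-elim x<y = x<y

  <-intro : ∀ {x y} ε → 0ℚ ℚ.< ε → (Eventually λ k → seq x k ℚ.+ ε ℚ.≤ seq y k) → x < y
  <-intro ε 0<ε le = ε , 0<ε , le

<-≤-trans : ∀ {x y z} → x < y → (Eventually λ k → seq y k ℚ.≤ seq z k) → x < z
<-≤-trans x<y (M , le) =
  let (ε , 0<ε , N , lt) = <-elim x<y
  in <-intro ε 0<ε (M ℕ.⊔ N , λ k le′ → ℚP.≤-trans (lt k (ℕP.m⊔n≤o⇒n≤o M N le′)) (le k (ℕP.m⊔n≤o⇒m≤o M N le′)))

infix 4 _≐_

-- Termwise equality with a constant, finer than `_≈_`. All heights in the play arise from rationals
-- by addition and emptying, so they satisfy it, and their comparisons become rational ones.
_≐_ : ℝ → ℚ → Set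
x ≐ q = ∀ k → seq x k ≡ q

+-≐ : ∀ {x y p q} → x ≐ p → y ≐ q → x + y ≐ p ℚ.+ q
+-≐ {x} {y} x≐p y≐q k = trans (seq-+ x y k) (cong₂ ℚ._+_ (x≐p k) (y≐q k))

≐⇒≤ : ∀ {x y p q} → x ≐ p → y ≐ q → p ℚ.≤ q → x ≤ y
≐⇒≤ x≐p y≐q p≤q = ≤-intro (0 , λ k _ → subst₂ ℚ._≤_ (sym (x≐p k)) (sym (y≐q k)) p≤q)

sum-≐ : ∀ {n} (v : Vector ℚ n) → sum (λ j → fromℚ (v j)) ≐ ∑ v
sum-≐ {zero}  v   = seq-0ℝ
sum-≐ {suc n} v   = +-≐ (seq-fromℚ (v zero)) (sum-≐ (λ j → v (suc j)))

updateAt-≐ : ∀ {n} {f : Vector ℝ n} {v : Vector ℚ n} i → (∀ j → f j ≐ v j) →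
             ∀ j → updateAt f i (const 0ℝ) j ≐ updateAt v i (const 0ℚ) j
updateAt-≐ zero    f≐v zero    = seq-0ℝ
updateAt-≐ zero    f≐v (suc j) = f≐v (suc j)
updateAt-≐ (suc i) f≐v zero    = f≐v zero
updateAt-≐ (suc i) f≐v (suc j) = updateAt-≐ i (λ j → f≐v (suc j)) j

-- A play never ends, so legal moves are needed even after the target height is reached: the whole
-- unit goes to a fullest cup, which is then emptied.
greedyMove : ∀ {μ} → 1ℚ ℚ.≤ μ → (v : Vector ℚ (suc n)) → NonNeg v → Move μ v
greedyMove {μ = μ} 1≤μ v 0≤v = record
  { pour = spike i 1ℚ
  ; choice = i
  ; pour-nonNeg = spike-≥0 i 0≤1
  ; pour-unit = ∑-spike i 1ℚ
  ; deceptive = λ j → ℚP.≤-trans (below j) inflate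
  }
  where
  0≤1 : 0ℚ ℚ.≤ 1ℚ
  0≤1 = ℚP.nonNegative⁻¹ 1ℚ

  i = proj₁ (argmax v)

  below : ∀ j → v j ℚ.+ spike i 1ℚ j ℚ.≤ v i ℚ.+ spike i 1ℚ i
  below j with j FinP.≟ i
  ... | yes refl = ℚP.≤-refl
  ... | no j≢i = ℚP.+-mono-≤ (proj₂ (argmax v) j)
    (ℚP.≤-trans (ℚP.≤-reflexive (spike-off i 1ℚ j≢i)) (spike-≥0 i 0≤1 i))

  inflate : v i ℚ.+ spike i 1ℚ i ℚ.≤ μ ℚ.* (v i ℚ.+ spike i 1ℚ i)
  inflate = ℚP.≤-trans (ℚP.≤-reflexive (sym (ℚP.*-identityˡ _)))
    (ℚP.*-monoʳ-≤-nonNeg _ {{ℚ.nonNegative (ℚP.+-mono-≤ (0≤v i) (spike-≥0 i 0≤1 i))}} 1≤μ)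

module Strategy {μ H : ℚ} (1≤μ : 1ℚ ℚ.≤ μ) {n : ℕ} where

  -- The last component is `nothing` once the winning strategy is used up. Nonnegativity is carried
  -- along for `greedyMove` and for the bounds on the estimates.
  State : Set
  State = Σ[ v ∈ Vector ℚ (suc n) ] (NonNeg v × Maybe (Win μ H v))

  heights : State → Vector ℚ (suc n)
  heights = proj₁

  after-nonNeg : ∀ {v : Vector ℚ (suc n)} (m : Move μ v) → NonNeg v → NonNeg (Move.after m)
  after-nonNeg m 0≤v j with j FinP.≟ Move.choice m
  ... | yes refl = ℚP.≤-reflexive (sym (updateAt-updates (Move.choice m) (Move.filled m)))
  ... | no j≢i   = ℚP.≤-trans (ℚP.+-mono-≤ (0≤v j) (Move.pour-nonNeg m j))
                     (ℚP.≤-reflexive (sym (updateAt-minimal j (Move.choice m) (Move.filled m) j≢i)))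

  nextMove : (s : State) → Move μ (heights s)
  nextMove (v , 0≤v , just (move m win)) = m
  nextMove (v , 0≤v , _)                 = greedyMove 1≤μ v 0≤v

  remaining : (s : State) → Maybe (Win μ H (Move.after (nextMove s)))
  remaining (v , 0≤v , just (move m win)) = just win
  remaining (v , 0≤v , just (done i le))  = nothing
  remaining (v , 0≤v , nothing)           = nothing

  next : State → State
  next s = Move.after (nextMove s) , after-nonNeg (nextMove s) (proj₁ (proj₂ s)) , remaining s

  run : State → ℕ → State
  run s zero    = s
  run s (suc t) = next (run s t)

  -- `run` adds steps at the end, whereas `attains` follows the strategy from its first move.
  run-next : ∀ s t → run (next s) t ≡ run s (suc t)
  run-next s zero    = refl
  run-next s (suc t) = cong next (run-next s t)

  attains : ∀ {v} (0≤v : NonNeg v) (win : Win μ H v) → ∃[ t ] ∃[ i ] H ℚ.≤ heights (run (v , 0≤v , just win) t) i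
  attains 0≤v (done i le)  = 0 , i , le
  attains 0≤v (move m win) =
    let (t , i , le) = attains (after-nonNeg m 0≤v) win
    in suc t , i , subst (λ s → H ℚ.≤ heights s i) (run-next _ t) le

  module _ {c : ℝ} (μ≤c : Eventually λ k → μ ℚ.≤ seq c k) (win : Win μ H {suc n} (const 0ℚ)) where

    start : State
    start = const 0ℚ , (λ _ → ℚP.≤-refl) , just win

    state : ℕ → State
    state = run start

    moves : ∀ t → Move μ (heights (state t))
    moves t = nextMove (state t)

    private module M t = Move (moves t)

    pourℝ : ℕ → Vector ℝ (suc n)
    pourℝ t j = fromℚ (M.pour t j)

    open Heights pourℝ M.choice

    mutual
      before-≐ : ∀ t j → before t j ≐ heights (state t) j
      before-≐ zero    j = seq-0ℝ
      before-≐ (suc t) j = updateAt-≐ (M.choice t) (filled-≐ t) j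

      filled-≐ : ∀ t j → filled t j ≐ M.filled t j
      filled-≐ t j = +-≐ (before-≐ t j) (seq-fromℚ (M.pour t j))

    filled-≥0 : ∀ t j → 0ℚ ℚ.≤ M.filled t j
    filled-≥0 t j = ℚP.+-mono-≤ (proj₁ (proj₂ (state t)) j) (M.pour-nonNeg t j)

    estimateℚ : ℕ → Vector ℚ (suc n)
    estimateℚ t = updateAt (M.filled t) (M.choice t) (μ ℚ.*_)

    filled≤μfilled : ∀ t j → M.filled t j ℚ.≤ μ ℚ.* M.filled t j
    filled≤μfilled t j = ℚP.≤-trans (ℚP.≤-reflexive (sym (ℚP.*-identityˡ _)))
      (ℚP.*-monoʳ-≤-nonNeg _ {{ℚ.nonNegative (filled-≥0 t j)}} 1≤μ)

    estimate-bounds : ∀ t j → M.filled t j ℚ.≤ estimateℚ t j × estimateℚ t j ℚ.≤ μ ℚ.* M.filled t j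
    estimate-bounds t j with j FinP.≟ M.choice t
    ... | yes refl = subst (λ e → M.filled t j ℚ.≤ e × e ℚ.≤ μ ℚ.* M.filled t j)
                       (sym (updateAt-updates j (M.filled t))) (filled≤μfilled t j , ℚP.≤-refl)
    ... | no j≢i   = subst (λ e → M.filled t j ℚ.≤ e × e ℚ.≤ μ ℚ.* M.filled t j)
                       (sym (updateAt-minimal j (M.choice t) (M.filled t) j≢i)) (ℚP.≤-refl , filled≤μfilled t j)

    estimate-greedy : ∀ t j → estimateℚ t j ℚ.≤ estimateℚ t (M.choice t)
    estimate-greedy t j with j FinP.≟ M.choice t
    ... | yes refl = ℚP.≤-refl
    ... | no j≢i   = subst₂ ℚ._≤_ (sym (updateAt-minimal j (M.choice t) (M.filled t) j≢i))
                       (sym (updateAt-updates (M.choice t) (M.filled t))) (M.deceptive t j)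

    play : Play c (suc n)
    play = record
      { pour = pourℝ
      ; estimate = λ t j → fromℚ (estimateℚ t j)
      ; choice = M.choice
      ; pour-nonNeg = λ t j → ≐⇒≤ seq-0ℝ (seq-fromℚ (M.pour t j)) (M.pour-nonNeg t j)
      ; pour-unit = λ t → ≈-intro (λ k → trans (sum-≐ (M.pour t) k) (trans (M.pour-unit t) (sym (seq-1ℝ k))))
      ; estimate-lower = λ t j → ≐⇒≤ (filled-≐ t j) (seq-fromℚ _) (proj₁ (estimate-bounds t j))
      -- The approximations of `c` are known to be at least `μ` only from some index on, so the
      -- comparison is made on that tail.
      ; estimate-upper = λ t j → ≤-intro (proj₁ μ≤c , λ k N≤k →
          subst₂ ℚ._≤_ (sym (seq-fromℚ (estimateℚ t j) k))
            (sym (trans (seq-* c (filled t j) k) (cong (seq c k ℚ.*_) (filled-≐ t j k))))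
            (ℚP.≤-trans (proj₂ (estimate-bounds t j))
              (ℚP.*-monoʳ-≤-nonNeg (M.filled t j) {{ℚ.nonNegative (filled-≥0 t j)}} (proj₂ μ≤c k N≤k))))
      }

    achieves : ∀ {b} → (Eventually λ k → seq b k ℚ.≤ H) → AdversaryAchieves c (suc n) b
    achieves (N , b≤H) = play ,
      (λ t j → ≐⇒≤ (seq-fromℚ _) (seq-fromℚ _) (estimate-greedy t j)) ,
      λ x x<b →
        let (t , i , H≤) = attains (λ _ → ℚP.≤-refl) win
        -- `done` measures heights between moves, that is, at the start of a step.
        in t , i , inj₁ (<-≤-trans x<b (N , λ k N≤k →
             ℚP.≤-trans (b≤H k N≤k) (ℚP.≤-trans H≤ (ℚP.≤-reflexive (sym (before-≐ t i k))))))

-- Bounds on the exponential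

p≤∣p∣ : ∀ p → p ℚ.≤ ℚ.∣ p ∣
p≤∣p∣ p with ℚP.≤-total 0ℚ p
... | inj₁ 0≤p = ℚP.≤-reflexive (sym (ℚP.0≤p⇒∣p∣≡p 0≤p))
... | inj₂ p≤0 = ℚP.≤-trans p≤0 (ℚP.0≤∣p∣ p)

-- In `exp-bound` the argument approximates a real and may be negative, hence the absolute value.
expTerm-mono : ∀ k {a b} → ℚ.∣ a ∣ ℚ.≤ b → expTerm k a ℚ.≤ expTerm k b
expTerm-mono k {a} ∣a∣≤b = ℚP.≤-trans (p≤∣p∣ (expTerm k a)) (∣expTerm∣ k ∣a∣≤b)

expSum-mono : ∀ n {a b} → ℚ.∣ a ∣ ℚ.≤ b → expSum n a ℚ.≤ expSum n b
expSum-mono zero    ∣a∣≤b = ℚP.≤-refl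
expSum-mono (suc n) ∣a∣≤b = ℚP.+-mono-≤ (expSum-mono n ∣a∣≤b) (expTerm-mono n ∣a∣≤b)

expSum-grows : ∀ {m n a} → 0ℚ ℚ.≤ a → m ℕ.≤′ n → expSum m a ℚ.≤ expSum n a
expSum-grows 0≤a (ℕ.≤′-reflexive refl) = ℚP.≤-refl
expSum-grows 0≤a (ℕ.≤′-step {n} m≤n)  = ℚP.≤-trans (expSum-grows 0≤a m≤n) (p≤p+q (expTerm-nonNeg n 0≤a))

-- (a + 1)ᵏ⁺¹ ≥ aᵏ⁺¹ + (k + 1) aᵏ, divided by (k + 1)!
expTerm-+1 : ∀ k {a} → 0ℚ ℚ.≤ a → expTerm (suc k) a ℚ.+ expTerm k a ℚ.≤ expTerm (suc k) (a ℚ.+ 1ℚ)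
expTerm-+1 zero {a} 0≤a = ℚP.≤-reflexive
  (solve 1 (λ a → (con 1ℚ :* a) :* con 1ℚ :+ con 1ℚ := (con 1ℚ :* (a :+ con 1ℚ)) :* con 1ℚ) refl a)
expTerm-+1 (suc k) {a} 0≤a = ℚP.*-cancelˡ-≤-pos N {{ℚ.positive (0<ℕ→ℚ-suc (suc k))}} (begin
  N ℚ.* (T (suc (suc k)) ℚ.+ T (suc k))
    ≡⟨ ℚP.*-distribˡ-+ N (T (suc (suc k))) (T (suc k)) ⟩
  N ℚ.* T (suc (suc k)) ℚ.+ N ℚ.* T (suc k)
    ≡⟨ cong₂ ℚ._+_ (expTerm-suc (suc k) a) (cong (ℚ._* T (suc k)) (ℕ→ℚ-suc (suc k))) ⟩
  T (suc k) ℚ.* a ℚ.+ (ℕ→ℚ (suc k) ℚ.+ 1ℚ) ℚ.* T (suc k)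
    ≡⟨ cong (T (suc k) ℚ.* a ℚ.+_) (trans (ℚP.*-distribʳ-+ (T (suc k)) (ℕ→ℚ (suc k)) 1ℚ)
         (cong₂ ℚ._+_ (expTerm-suc k a) (ℚP.*-identityˡ (T (suc k))))) ⟩
  T (suc k) ℚ.* a ℚ.+ (T k ℚ.* a ℚ.+ T (suc k))
    ≤⟨ p≤p+q (expTerm-nonNeg k 0≤a) ⟩
  (T (suc k) ℚ.* a ℚ.+ (T k ℚ.* a ℚ.+ T (suc k))) ℚ.+ T k
    ≡⟨ solve 3 (λ a x y → (x :* a :+ (y :* a :+ x)) :+ y := (x :+ y) :* (a :+ con 1ℚ)) refl a (T (suc k)) (T k) ⟩
  (T (suc k) ℚ.+ T k) ℚ.* (a ℚ.+ 1ℚ)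
    ≤⟨ ℚP.*-monoʳ-≤-nonNeg (a ℚ.+ 1ℚ) {{ℚ.nonNegative (ℚP.+-mono-≤ 0≤a (ℚP.nonNegative⁻¹ 1ℚ))}} (expTerm-+1 k 0≤a) ⟩
  expTerm (suc k) (a ℚ.+ 1ℚ) ℚ.* (a ℚ.+ 1ℚ)
    ≡⟨ sym (expTerm-suc (suc k) (a ℚ.+ 1ℚ)) ⟩
  N ℚ.* expTerm (suc (suc k)) (a ℚ.+ 1ℚ) ∎)
  where
  open ℚP.≤-Reasoning
  N = ℕ→ℚ (suc (suc k))
  T : ℕ → ℚ
  T k = expTerm k a

-- A truncated form of exp (a + 1) ≥ 2 exp a; the second sum is one term shorter because
-- `expTerm-+1` pairs consecutive terms.
expSum-+1 : ∀ n {a} → 0ℚ ℚ.≤ a → expSum (suc n) a ℚ.+ expSum n a ℚ.≤ expSum (suc n) (a ℚ.+ 1ℚ)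
expSum-+1 zero    0≤a = ℚP.≤-refl
expSum-+1 (suc n) {a} 0≤a = ℚP.≤-trans
  (ℚP.≤-reflexive (solve 4 (λ s t s′ t′ → (s :+ t) :+ (s′ :+ t′) := (s :+ s′) :+ (t :+ t′)) refl
    (expSum (suc n) a) (expTerm (suc n) a) (expSum n a) (expTerm n a)))
  (ℚP.+-mono-≤ (expSum-+1 n 0≤a) (expTerm-+1 n 0≤a))

-- Start from exp 0 = 1 and double m times; every doubling costs one more term of the series.
2^m≤expSum : ∀ m → ℕ→ℚ (2 ℕ.^ m) ℚ.≤ expSum (suc m) (ℕ→ℚ m)
2^m≤expSum zero    = ℚP.≤-refl
2^m≤expSum (suc m) = begin
  ℕ→ℚ (2 ℕ.^ suc m)
    ≡⟨ ℕ→ℚ-2^suc m ⟩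
  ℕ→ℚ (2 ℕ.^ m) ℚ.+ ℕ→ℚ (2 ℕ.^ m)
    ≤⟨ ℚP.+-mono-≤ (ℚP.≤-trans (2^m≤expSum m) (p≤p+q (expTerm-nonNeg (suc m) (0≤ℕ→ℚ m)))) (2^m≤expSum m) ⟩
  expSum (suc (suc m)) (ℕ→ℚ m) ℚ.+ expSum (suc m) (ℕ→ℚ m)
    ≤⟨ expSum-+1 (suc m) (0≤ℕ→ℚ m) ⟩
  expSum (suc (suc m)) (ℕ→ℚ m ℚ.+ 1ℚ)
    ≡⟨ cong (expSum (suc (suc m))) (sym (ℕ→ℚ-suc m)) ⟩
  expSum (suc (suc m)) (ℕ→ℚ (suc m)) ∎
  where open ℚP.≤-Reasoning

halving : ∀ {x y} → x ℚ.- y ℚ.≤ ½ ℚ.* x → x ℚ.≤ y ℚ.+ y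
halving {x} {y} le = begin
  x                                             ≡⟨ solve 2 (λ x y → x := ((x :- y) :+ (x :- y)) :+ ((y :+ y) :- x)) refl x y ⟩
  ((x ℚ.- y) ℚ.+ (x ℚ.- y)) ℚ.+ ((y ℚ.+ y) ℚ.- x)   ≤⟨ ℚP.+-monoˡ-≤ ((y ℚ.+ y) ℚ.- x) (ℚP.+-mono-≤ le le) ⟩
  (½ ℚ.* x ℚ.+ ½ ℚ.* x) ℚ.+ ((y ℚ.+ y) ℚ.- x)   ≡⟨ solve 2 (λ x y → (con ½ :* x :+ con ½ :* x) :+ ((y :+ y) :- x) := y :+ y) refl x y ⟩
  y ℚ.+ y                                       ∎
  where open ℚP.≤-Reasoning

expTerm-0 : ∀ k → expTerm (suc k) 0ℚ ≡ 0ℚ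
expTerm-0 k = trans (cong (ℚ._* (ℤ.+ 1 ℚ./ suc k)) (ℚP.*-zeroʳ (expTerm k 0ℚ))) (ℚP.*-zeroˡ (ℤ.+ 1 ℚ./ suc k))

expSum-0 : ∀ n → expSum (suc n) 0ℚ ≡ 1ℚ
expSum-0 zero    = refl
expSum-0 (suc n) = cong₂ ℚ._+_ (expSum-0 n) (expTerm-0 n)

-- The mean value bound exp b − exp a ≤ (b − a) exp b, for b − a = ½, gives exp b ≤ 2 exp a.
expSum≤2^m : ∀ n m → expSum n (ℕ→ℚ m ℚ.* ½) ℚ.≤ ℕ→ℚ (2 ℕ.^ m)
expSum≤2^m zero      m    = 0≤ℕ→ℚ (2 ℕ.^ m)
expSum≤2^m (suc n)   zero = ℚP.≤-reflexive (expSum-0 n)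
expSum≤2^m n@(suc _) (suc m) = begin
  expSum n b                            ≤⟨ halving (ℚP.≤-trans (p≤∣p∣ _) (ℚP.≤-trans
                                             (expSum-lip ∣b∣≤b ∣a∣≤b n)
                                             (ℚP.≤-reflexive (cong (ℚ._* expSum n b) (cong ℚ.∣_∣ gap))))) ⟩
  expSum n a ℚ.+ expSum n a             ≤⟨ ℚP.+-mono-≤ (expSum≤2^m n m) (expSum≤2^m n m) ⟩
  ℕ→ℚ (2 ℕ.^ m) ℚ.+ ℕ→ℚ (2 ℕ.^ m)       ≡⟨ sym (ℕ→ℚ-2^suc m) ⟩
  ℕ→ℚ (2 ℕ.^ suc m)                     ∎
  where
  open ℚP.≤-Reasoning
  a = ℕ→ℚ m ℚ.* ½
  b = ℕ→ℚ (suc m) ℚ.* ½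

  0≤a : 0ℚ ℚ.≤ a
  0≤a = 0≤* (0≤ℕ→ℚ m) (ℚP.nonNegative⁻¹ ½)

  a≤b : a ℚ.≤ b
  a≤b = ℚP.*-monoʳ-≤-nonNeg ½ (ℕ→ℚ-≤-suc m)

  ∣a∣≤b : ℚ.∣ a ∣ ℚ.≤ b
  ∣a∣≤b = ℚP.≤-trans (ℚP.≤-reflexive (ℚP.0≤p⇒∣p∣≡p 0≤a)) a≤b

  ∣b∣≤b : ℚ.∣ b ∣ ℚ.≤ b
  ∣b∣≤b = ℚP.≤-reflexive (ℚP.0≤p⇒∣p∣≡p (ℚP.≤-trans 0≤a a≤b))

  gap : b ℚ.- a ≡ ½
  gap = trans (cong (λ z → z ℚ.* ½ ℚ.- a) (ℕ→ℚ-suc m))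
    (solve 1 (λ x → (x :+ con 1ℚ) :* con ½ :- x :* con ½ := con ½) refl (ℕ→ℚ m))

-- If a late approximation of `ℓ` exceeded m + 1, its exponential sum would be at least 2^(m+1), yet
-- that sum lies within ½ of n ≤ 2^m.
log-bound : ∀ {n ℓ} → IsLog ℓ (fromℕ n) → ∀ {m} → n ℕ.≤ 2 ℕ.^ m →
            Eventually λ k → seq ℓ k ℚ.≤ ℕ→ℚ (suc m)
log-bound {n} {ℓ} log {m} n≤2^m =
  let (N , near) = ≈-elim log ½ (ℚP.positive⁻¹ ½)
  -- From index m + 2 on, the partial sum has the terms that `2^m≤expSum (suc m)` asks for.
  in N ℕ.+ suc (suc m) , λ k le → bound-at k
       (near k (ℕP.m+n≤o⇒m≤o N le)) (ℕP.≤⇒≤′ (ℕP.m+n≤o⇒n≤o N le))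
  where
  open ℚP.≤-Reasoning
  bound-at : ∀ k → ℚ.∣ seq (exp ℓ) k ℚ.- seq (fromℕ n) k ∣ ℚ.≤ ½ → suc (suc m) ℕ.≤′ k →
             seq ℓ k ℚ.≤ ℕ→ℚ (suc m)
  bound-at k near m<k with seq ℓ k ℚP.≤? ℕ→ℚ (suc m)
  ... | yes le = le
  ... | no  gt = contradiction (ℚP.<-≤-trans room too-big) (ℚP.<-irrefl refl)
    where
    p = ℕ→ℚ (2 ℕ.^ m)
    ½<1 : ½ ℚ.< 1ℚ
    ½<1 = ℚP.+-monoʳ-< ½ (ℚP.positive⁻¹ ½)

    room : p ℚ.+ ½ ℚ.< p ℚ.+ p
    room = ℚP.+-monoʳ-< p (ℚP.<-≤-trans ½<1 (ℕ→ℚ-mono (ℕP.m^n>0 2 m)))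

    too-big : p ℚ.+ p ℚ.≤ p ℚ.+ ½
    too-big = begin
      p ℚ.+ p                             ≡⟨ sym (ℕ→ℚ-2^suc m) ⟩
      ℕ→ℚ (2 ℕ.^ suc m)                   ≤⟨ 2^m≤expSum (suc m) ⟩
      expSum (suc (suc m)) (ℕ→ℚ (suc m))  ≤⟨ expSum-grows (0≤ℕ→ℚ (suc m)) m<k ⟩
      expSum k (ℕ→ℚ (suc m))              ≤⟨ expSum-mono k (ℚP.≤-trans (ℚP.≤-reflexive (ℚP.0≤p⇒∣p∣≡p (0≤ℕ→ℚ (suc m))))
                                               (ℚP.<⇒≤ (ℚP.≰⇒> gt))) ⟩
      expSum k (seq ℓ k)                  ≡⟨ solve 2 (λ e x → e := x :+ (e :- x)) refl (expSum k (seq ℓ k)) (ℕ→ℚ n) ⟩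
      ℕ→ℚ n ℚ.+ (expSum k (seq ℓ k) ℚ.- ℕ→ℚ n)
        ≤⟨ ℚP.+-mono-≤ (ℕ→ℚ-mono n≤2^m) (ℚP.≤-trans (p≤∣p∣ _)
             (subst₂ (λ x y → ℚ.∣ x ℚ.- y ∣ ℚ.≤ ½) (seq-exp ℓ k) (seq-fromℕ n k) near)) ⟩
      p ℚ.+ ½                             ∎

-- Otherwise y < |x| would give y² < |x|² = x².
∣∣≤-from-square : ∀ {x y} → 0ℚ ℚ.≤ y → x ℚ.* x ℚ.≤ y ℚ.* y → ℚ.∣ x ∣ ℚ.≤ y
∣∣≤-from-square {x} {y} 0≤y x²≤y² with ℚ.∣ x ∣ ℚP.≤? y
... | yes le = le
... | no  gt = contradiction (begin-strict
  y ℚ.* y                  ≤⟨ ℚP.*-monoˡ-≤-nonNeg y {{ℚ.nonNegative 0≤y}} (ℚP.<⇒≤ y<∣x∣) ⟩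
  y ℚ.* ℚ.∣ x ∣            <⟨ ℚP.*-monoˡ-<-pos ℚ.∣ x ∣ {{ℚ.positive (ℚP.≤-<-trans 0≤y y<∣x∣)}} y<∣x∣ ⟩
  ℚ.∣ x ∣ ℚ.* ℚ.∣ x ∣      ≡⟨ sym (ℚP.∣p*q∣≡∣p∣*∣q∣ x x) ⟩
  ℚ.∣ x ℚ.* x ∣            ≡⟨ ℚP.0≤p⇒∣p∣≡p (square-≥0 x) ⟩
  x ℚ.* x                  ≤⟨ x²≤y² ⟩
  y ℚ.* y                  ∎) (ℚP.<-irrefl refl)
  where
  open ℚP.≤-Reasoning
  y<∣x∣ = ℚP.≰⇒> gt
  square-≥0 : ∀ x → 0ℚ ℚ.≤ x ℚ.* x
  square-≥0 x with ℚP.≤-total 0ℚ x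
  ... | inj₁ 0≤x = 0≤* 0≤x 0≤x
  ... | inj₂ x≤0 = ℚP.≤-trans (0≤* 0≤-x 0≤-x) (ℚP.≤-reflexive
                     (solve 1 (λ x → (:- x) :* (:- x) := x :* x) refl x))
    where 0≤-x = ℚP.neg-antimono-≤ x≤0

-- The tolerance 1 in comparing `s * s` with `ℓ` accounts for the step from m + 1 to m + 2.
sqrt-bound : ∀ {ℓ s} → IsSqrt s ℓ → ∀ {m w} → suc (suc m) ℕ.≤ w ℕ.* w →
             (Eventually λ k → seq ℓ k ℚ.≤ ℕ→ℚ (suc m)) →
             Eventually λ k → ℚ.∣ seq s k ∣ ℚ.≤ ℕ→ℚ w
sqrt-bound {ℓ} {s} (_ , s²≈ℓ) {m} {w} m+2≤w² (M , ℓ≤) =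
  let (N , near) = ≈-elim s²≈ℓ 1ℚ (ℚP.positive⁻¹ 1ℚ)
  in M ℕ.+ N , λ k le → ∣∣≤-from-square (0≤ℕ→ℚ w) (begin
    seq s k ℚ.* seq s k
      ≡⟨ solve 2 (λ e x → e := x :+ (e :- x)) refl (seq s k ℚ.* seq s k) (seq ℓ k) ⟩
    seq ℓ k ℚ.+ (seq s k ℚ.* seq s k ℚ.- seq ℓ k)
      ≤⟨ ℚP.+-mono-≤ (ℓ≤ k (ℕP.m+n≤o⇒m≤o M le)) (ℚP.≤-trans (p≤∣p∣ _)
           (subst (λ x → ℚ.∣ x ℚ.- seq ℓ k ∣ ℚ.≤ 1ℚ) (seq-* s s k) (near k (ℕP.m+n≤o⇒n≤o M le)))) ⟩
    ℕ→ℚ (suc m) ℚ.+ 1ℚ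
      ≡⟨ sym (ℕ→ℚ-suc (suc m)) ⟩
    ℕ→ℚ (suc (suc m))
      ≤⟨ ℕ→ℚ-mono m+2≤w² ⟩
    ℕ→ℚ (w ℕ.* w)
      ≡⟨ ℕ→ℚ-* w w ⟩
    ℕ→ℚ w ℚ.* ℕ→ℚ w ∎)
  where open ℚP.≤-Reasoning

-- The factor ½ matches `expSum≤2^m`, where each half unit in the exponent costs at most a doubling.
exp-bound : ∀ {d s w m} → 0ℚ ℚ.≤ d → (Eventually λ k → ℚ.∣ seq s k ∣ ℚ.≤ w) → d ℚ.* w ℚ.≤ ℕ→ℚ m ℚ.* ½ →
            Eventually λ k → seq (exp (fromℚ d * s)) k ℚ.≤ ℕ→ℚ (2 ℕ.^ m)
exp-bound {d} {s} {w} {m} 0≤d (N , s≤w) dw≤ = N , λ k N≤k → begin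
  seq (exp (fromℚ d * s)) k         ≡⟨ seq-exp (fromℚ d * s) k ⟩
  expSum k (seq (fromℚ d * s) k)    ≤⟨ expSum-mono k (small k (s≤w k N≤k)) ⟩
  expSum k (ℕ→ℚ m ℚ.* ½)            ≤⟨ expSum≤2^m k m ⟩
  ℕ→ℚ (2 ℕ.^ m)                     ∎
  where
  open ℚP.≤-Reasoning
  small : ∀ k → ℚ.∣ seq s k ∣ ℚ.≤ w → ℚ.∣ seq (fromℚ d * s) k ∣ ℚ.≤ ℕ→ℚ m ℚ.* ½
  small k le = begin
    ℚ.∣ seq (fromℚ d * s) k ∣    ≡⟨ cong ℚ.∣_∣ (trans (seq-* (fromℚ d) s k) (cong (ℚ._* seq s k) (seq-fromℚ d k))) ⟩
    ℚ.∣ d ℚ.* seq s k ∣          ≡⟨ trans (ℚP.∣p*q∣≡∣p∣*∣q∣ d (seq s k)) (cong (ℚ._* ℚ.∣ seq s k ∣) (ℚP.0≤p⇒∣p∣≡p 0≤d)) ⟩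
    d ℚ.* ℚ.∣ seq s k ∣          ≤⟨ ℚP.*-monoˡ-≤-nonNeg d {{ℚ.nonNegative 0≤d}} le ⟩
    d ℚ.* w                      ≤⟨ dw≤ ⟩
    ℕ→ℚ m ℚ.* ½                  ∎

-- Choosing the level for a given number of cups

n<2^n : ∀ n → n ℕ.< 2 ℕ.^ n
n<2^n zero    = ℕ.s≤s ℕ.z≤n
n<2^n (suc n) = subst (suc (suc n) ℕ.≤_) (cong (2 ℕ.^ n ℕ.+_) (sym (ℕP.+-identityʳ _)))
  (ℕP.+-mono-≤ (ℕP.m^n>0 2 n) (n<2^n n))

-- Search downwards from an index where `f` exceeds `n`: at the first value that does not, the one
-- above has just been seen to exceed it.
bracket : (f : ℕ → ℕ) → ∀ {n} → f 0 ℕ.≤ n → ∀ k → n ℕ.< f k → ∃[ j ] (f j ℕ.≤ n × n ℕ.< f (suc j))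
bracket f f0≤n zero    n<f0 = contradiction f0≤n (ℕP.<⇒≱ n<f0)
bracket f {n} f0≤n (suc k) n<f with f k ℕP.≤? n
... | yes fk≤n = k , fk≤n , n<f
... | no  fk≰n = bracket f f0≤n k (ℕP.≰⇒> fk≰n)

-- With q = p + 1: k + 4 ≤ 4(k + 1) and q ≤ q² bound the left side by 16q²(k + 1)² + 2, so the
-- constant 5 suffices. The proof exhibits the difference as a polynomial with natural coefficients.
log-size : ∀ p k → suc (suc (suc p ℕ.* ((k ℕ.+ 4) ℕ.* (k ℕ.+ 4)))) ℕ.≤
           (5 ℕ.* suc p ℕ.* suc k) ℕ.* (5 ℕ.* suc p ℕ.* suc k)
log-size p k = subst (suc (suc (suc p ℕ.* ((k ℕ.+ 4) ℕ.* (k ℕ.+ 4)))) ℕ.≤_) (difference p k) (ℕP.m≤m+n _ _)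
  where
  difference : ∀ p k → suc (suc (suc p ℕ.* ((k ℕ.+ 4) ℕ.* (k ℕ.+ 4)))) ℕ.+
      (7 ℕ.+ 42 ℕ.* k ℕ.+ 24 ℕ.* (k ℕ.* k) ℕ.+ p ℕ.* (34 ℕ.+ 92 ℕ.* k ℕ.+ 49 ℕ.* (k ℕ.* k))
        ℕ.+ 25 ℕ.* (p ℕ.* p) ℕ.* ((k ℕ.+ 1) ℕ.* (k ℕ.+ 1)))
    ≡ (5 ℕ.* suc p ℕ.* suc k) ℕ.* (5 ℕ.* suc p ℕ.* suc k)
  difference = solve-∀

theorem4 : ∀ c → 1ℝ < c →
    ∃[ δ ] (0ℝ < δ × ∃[ n₀ ] ∀ n → n ≥ℕ n₀ →
    ∀ ℓ s → IsLog ℓ (fromℕ n) → IsSqrt s ℓ →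
    AdversaryAchieves c n (exp (δ * s)))
theorem4 c 1<c = fromℚ d , 0<δ , size 0 , backlog
  where
  -- Strict inequality of reals supplies a rational ε > 0 such that 1 + ε is eventually at most the
  -- approximations of `c`.
  gap = <-elim 1<c
  ε = proj₁ gap
  0<ε : 0ℚ ℚ.< ε
  0<ε = proj₁ (proj₂ gap)
  arch = archimedean 1ℚ 0<ε
  -- The successor makes q positive, as `height-bound` and the division by 5q require.
  q = suc (proj₁ arch)

  1≤qε : 1ℚ ℚ.≤ ℕ→ℚ q ℚ.* ε
  1≤qε = ℚP.≤-trans (proj₂ arch)
    (ℚP.*-monoʳ-≤-nonNeg ε {{ℚ.nonNegative (ℚP.<⇒≤ 0<ε)}} (ℕ→ℚ-≤-suc (proj₁ arch)))

  open Climb 0<ε q 1≤qε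

  μ≤c : Eventually λ k → μ ℚ.≤ seq c k
  μ≤c = proj₁ (proj₂ (proj₂ gap)) , λ k N≤k →
    subst (λ x → x ℚ.+ ε ℚ.≤ seq c k) (seq-1ℝ k) (proj₂ (proj₂ (proj₂ gap)) k N≤k)

  -- If q (k + 3)² ≤ log₂ n < q (k + 4)² then √(log n) ≤ 5 q (k + 1), so that δ = 1/(10 q)
  -- gives exp (δ √(log n)) ≤ exp ((k + 1)/2) ≤ 2ᵏ⁺¹, a height reached at level k + 3.

  scaled = scale (0<ℕ→ℚ-suc (4 ℕ.+ 5 ℕ.* proj₁ arch)) (ℚP.positive⁻¹ ½)
  d = proj₁ scaled
  0<d : 0ℚ ℚ.< d
  0<d = proj₁ (proj₂ scaled)

  -- `scale` was applied to 5q in the successor form 5 + 5p, where q = p + 1.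
  5qd≡½ : ℕ→ℚ (5 ℕ.* q) ℚ.* d ≡ ½
  5qd≡½ = trans (cong (λ m → ℕ→ℚ m ℚ.* d) (ℕP.*-suc 5 (proj₁ arch))) (proj₂ (proj₂ scaled))

  0<δ : 0ℝ < fromℚ d
  0<δ = <-intro d 0<d (0 , λ k _ → ℚP.≤-reflexive
    (trans (cong (ℚ._+ d) (seq-0ℝ k)) (trans (ℚP.+-identityˡ d) (sym (seq-fromℚ d k)))))

  -- This many cups suffice for level k + 3. The threshold `size 0` makes the bracketing of n
  -- possible from k = 0.
  size : ℕ → ℕ
  size k = 2 ℕ.^ (q ℕ.* ((k ℕ.+ 3) ℕ.* (k ℕ.+ 3)))

  size-large : ∀ n → n ℕ.< size n
  size-large n = ℕP.<-≤-trans (n<2^n n) (ℕP.^-monoʳ-≤ 2 (begin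
    n                                   ≤⟨ ℕP.m≤m+n n 3 ⟩
    n ℕ.+ 3                             ≤⟨ ℕP.m≤m*n (n ℕ.+ 3) (n ℕ.+ 3) {{ℕ.>-nonZero (ℕP.≤-trans (ℕ.s≤s ℕ.z≤n) (ℕP.m≤n+m 3 n))}} ⟩
    (n ℕ.+ 3) ℕ.* (n ℕ.+ 3)             ≤⟨ ℕP.m≤n*m _ q ⟩
    q ℕ.* ((n ℕ.+ 3) ℕ.* (n ℕ.+ 3))     ∎))
    where open ℕP.≤-Reasoning

  backlog : ∀ n → n ≥ℕ size 0 → ∀ ℓ s → IsLog ℓ (fromℕ n) → IsSqrt s ℓ →
            AdversaryAchieves c n (exp (fromℚ d * s))
  backlog zero    large = contradiction large (ℕP.<⇒≱ (ℕP.m^n>0 2 (q ℕ.* 9)))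
  backlog (suc n) large ℓ s log sqrt = Strategy.achieves 1≤μ μ≤c (climb-zero (k ℕ.+ 3) fits)
    (proj₁ small , λ i N≤i → ℚP.≤-trans (proj₂ small i N≤i) high)
    where
    -- The search starts at the number of cups itself, an index where `size` is already larger.
    found = bracket size large (suc n) (size-large (suc n))
    k = proj₁ found

    fits : need (k ℕ.+ 3) ℕ.≤ suc n
    fits = ℕP.≤-trans (need-bound (k ℕ.+ 3)) (proj₁ (proj₂ found))

    m = q ℕ.* ((k ℕ.+ 4) ℕ.* (k ℕ.+ 4))

    n≤ : suc n ℕ.≤ 2 ℕ.^ m
    n≤ = subst (λ m → suc n ℕ.≤ 2 ℕ.^ (q ℕ.* (m ℕ.* m))) (sym (ℕP.+-suc k 3)) (ℕP.<⇒≤ (proj₂ (proj₂ found)))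

    w = 5 ℕ.* q ℕ.* suc k

    dw : d ℚ.* ℕ→ℚ w ℚ.≤ ℕ→ℚ (suc k) ℚ.* ½
    dw = ℚP.≤-reflexive (trans (cong (d ℚ.*_) (ℕ→ℚ-* (5 ℕ.* q) (suc k)))
      (trans (solve 3 (λ d f x → d :* (f :* x) := x :* (f :* d)) refl d (ℕ→ℚ (5 ℕ.* q)) (ℕ→ℚ (suc k)))
        (cong (ℕ→ℚ (suc k) ℚ.*_) 5qd≡½)))

    small : Eventually λ i → seq (exp (fromℚ d * s)) i ℚ.≤ ℕ→ℚ (2 ℕ.^ suc k)
    small = exp-bound {m = suc k} (ℚP.<⇒≤ 0<d)
      (sqrt-bound {ℓ} {s} sqrt {w = w} (log-size (proj₁ arch) k) (log-bound log {m} n≤)) dw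

    high : ℕ→ℚ (2 ℕ.^ suc k) ℚ.≤ height (k ℕ.+ 3)
    high = subst (λ m → ℕ→ℚ (2 ℕ.^ suc k) ℚ.≤ height m) (ℕP.+-comm 3 k) (height-bound (ℕ.s≤s ℕ.z≤n) (suc k))
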